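{- Let $n\in\mathbb{N}$, let $\psi:\mathbb{N}\to\mathbb{R}$ be a non-increasing function, and let $A=(\alpha_0,\alpha_1,\dots,\alpha_{n-1})^t\in M_{n,1}$ satisfy $A\notin\mathcal{W}_n^{ - }(n,1)$. If $$\sum_{k=1}^{\infty}k^{n-1}\psi(k)<\infty,$$ then $|\mathcal{L}(\mathcal{M}_A,\psi)|=0$, where $|\cdot|$ denotes the volume measure on the hyperplane $\mathcal{M}_A\subset\mathbb{R}^n$.
   Context: $M_{n,1}$ is the set of real matrices with $n$ rows and one column, written $A=(\alpha_i)_{0\le i\le n-1}$. For $v>0$, $\mathcal{W}_v(n,1)$ is the set of all $A=(\alpha_i)_{0\le i\le n-1}\in M_{n,1}$ for which there are infinitely many $q\in\mathbb{Z}$ such that $\max_i|p_i+\alpha_i q|<|q|^{ -v}$ for some $\mathbf{p}=(p_0,\dots,p_{n-1})\in\mathbb{Z}^n$. For $v>0$, $\mathcal{W}_v^{ - }(n,1)=\bigcap_{0<u<v}\mathcal{W}_u(n,1)$. For $\mathbf{x}=(x_1,\dots,x_{n-1})\in\mathbb{R}^{n-1}$ put $\tilde{\mathbf{x}}=(1,x_1,\dots,x_{n-1})\in\mathbb{R}^n$, so $\tilde{\mathbf{x}}A=\alpha_0+\sum_{i=1}^{n-1}\alpha_i x_i$. The hyperplane attached to $A$ is $\mathcal{M}_A=\{(\mathbf{x},\tilde{\mathbf{x}}A)\mid \mathbf{x}\in\mathbb{R}^{n-1}\}\subset\mathbb{R}^n$; its volume measure is the $(n-1)$-dimensional one. For a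 submanifold $\mathcal{M}\subset\mathbb{R}^n$, $\mathcal{L}(\mathcal{M},\psi)$ is the set of $\mathbf{y}\in\mathcal{M}$ such that for infinitely many $\mathbf{q}\in\mathbb{Z}^n$ there is some $p\in\mathbb{Z}$ with $|p+\mathbf{y}\cdot\mathbf{q}|<\psi(\|\mathbf{q}\|)$, where $\|\mathbf{q}\|=\max\{|q_1|,\dots,|q_n|\}$. (The value $\mathbf q=0$ plays no role.) -}

module Defs where

open import Algebra.Bundles using (CommutativeRing; Semiring)
import Algebra.Construct.NaturalChoice.Max as Max
import Algebra.Definitions.RawSemiring as RawSemiringDefs
import Algebra.Properties.Ring as RingProperties
open import Axiom.ExcludedMiddle using (ExcludedMiddle)
open import Data.Empty using (⊥; ⊥-elim)
open import Data.Fin.Base using (zero; suc; fromℕ; toℕ)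
open import Data.Integer.Base as ℤ using (ℤ; +_; -[1+_])
open import Data.List.Base using (List)
open import Data.List.Membership.Propositional using (_∈_)
open import Data.Maybe.Base using (Maybe; just; nothing)
open import Data.Nat.Base as ℕ using (ℕ; zero; suc; NonZero; ≢-nonZero)
import Data.Integer.Properties as ℤₚ
open import Data.Product.Base using (Σ; ∃; _,_; proj₁; proj₂) renaming (_×_ to _∧_)
open import Data.Sum.Base using (inj₁; inj₂)
open import Data.Vec.Base as Vec using (Vec; lookup)
open import Data.Vec.Functional as Vector using (Vector; _∷_; tail; insertAt)
open import Level using (0ℓ)
open import Relation.Binary.Bundles using (TotalOrder)
import Relation.Binary.Construct.NonStrictToStrict as Strict
open import Relation.Binary.PropositionalEquality.Core using (_≢_)
import Relation.Binary.Reasoning.Setoid as SetoidReasoning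
open import Relation.Binary.Structures using (IsTotalOrder)
open import Relation.Nullary using (¬_; yes; no)
open import Relation.Unary using (Pred)

InfinitelyMany : {X : Set} → Pred X 0ℓ → Set
InfinitelyMany {X} P = ¬ ∃ λ (xs : List X) → ∀ x → P x → x ∈ xs

-- ‖ q ‖ = max |qᵢ|
‖_‖ : ∀ {n} → Vec ℤ n → ℕ
‖ q ‖ = Vec.foldr′ ℕ._⊔_ 0 (Vec.map ℤ.∣_∣ q)

-- The standard library has no real numbers.  They are axiomatised as a
-- Dedekind-complete ordered field, which is unique up to isomorphism.
record RealField : Set₁ where
  infix 4 _≤_
  field
    commutativeRing : CommutativeRing 0ℓ 0ℓ

  open CommutativeRing commutativeRing public
    renaming (Carrier to ℝ; zero to *-zero)

  field
    _≤_          : ℝ → ℝ → Set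
    isTotalOrder : IsTotalOrder _≈_ _≤_
    1≉0          : ¬ (1# ≈ 0#)
    inverse      : ∀ x → ¬ (x ≈ 0#) → ∃ λ y → x * y ≈ 1#
    +-monoˡ-≤    : ∀ {x y} z → x ≤ y → x + z ≤ y + z
    *-nonNeg     : ∀ {x y} → 0# ≤ x → 0# ≤ y → 0# ≤ x * y

  IsUpperBound : Pred ℝ 0ℓ → Pred ℝ 0ℓ
  IsUpperBound P b = ∀ x → P x → x ≤ b

  IsSupremum : Pred ℝ 0ℓ → Pred ℝ 0ℓ
  IsSupremum P s = IsUpperBound P s ∧ (∀ b → IsUpperBound P b → s ≤ b)

  field
    complete : (P : Pred ℝ 0ℓ) → ∃ P → ∃ (IsUpperBound P) → ∃ (IsSupremum P)

-- Excluded middle enters the definitions only because the supremum defining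
-- a real power exists by the Archimedean property.
module RealAnalysis (em : ExcludedMiddle 0ℓ) (R : RealField) where

  open RealField R public
  open RawSemiringDefs (Semiring.rawSemiring semiring) public using (_×_; _^_; sum; product)

  ≤-totalOrder : TotalOrder 0ℓ 0ℓ 0ℓ
  ≤-totalOrder = record { isTotalOrder = isTotalOrder }

  open Max ≤-totalOrder public using (_⊔_)
  open Strict _≈_ _≤_ public using (_<_)

  ∣_∣ : ℝ → ℝ
  ∣ x ∣ = x ⊔ (- x)

  ℕ⇒ℝ : ℕ → ℝ
  ℕ⇒ℝ n = n × 1#

  ℤ⇒ℝ : ℤ → ℝ
  ℤ⇒ℝ (+ n)    = ℕ⇒ℝ n
  ℤ⇒ℝ -[1+ n ] = - ℕ⇒ℝ (suc n)

  _·_ : ∀ {n} → Vector ℝ n → Vector ℝ n → ℝ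
  x · y = sum (Vector.zipWith _*_ x y)

  _≋_ : ∀ {n} → Vector ℝ n → Vector ℝ n → Set
  x ≋ y = ∀ i → x i ≈ y i

  maxNorm : ∀ {n} → Vector ℝ n → ℝ
  maxNorm x = Vector.foldr _⊔_ 0# (Vector.map ∣_∣ x)

  -- The sum of f 0 , … , f (N ∸ 1).
  partialSum : (ℕ → ℝ) → ℕ → ℝ
  partialSum f N = sum {N} (λ i → f (toℕ i))

  -- Σ_{k ≥ 1} f k < ∞, the sum being taken in [-∞ , ∞].  For the series of
  -- terms of eventually constant sign considered here, this means that the
  -- partial sums are bounded above.
  SeriesFinite : (ℕ → ℝ) → Set
  SeriesFinite f = ∃ λ b → ∀ N → partialSum (λ k → f (suc k)) N ≤ b

  open IsTotalOrder isTotalOrder using ()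
    renaming ( refl to ≤-refl; reflexive to ≤-reflexive; trans to ≤-trans
             ; antisym to ≤-antisym; total to ≤-total )
  open RingProperties ring
  open SetoidReasoning setoid

  ≤-resp : ∀ {x x′ y y′} → x ≈ x′ → y ≈ y′ → x ≤ y → x′ ≤ y′
  ≤-resp p q r = ≤-trans (≤-reflexive (sym p)) (≤-trans r (≤-reflexive q))

  +-monoʳ-≤ : ∀ {x y} z → x ≤ y → z + x ≤ z + y
  +-monoʳ-≤ z p = ≤-resp (+-comm _ z) (+-comm _ z) (+-monoˡ-≤ z p)

  cancel : ∀ x y → (x + y) + - y ≈ x
  cancel x y = begin
    (x + y) + - y  ≈⟨ +-assoc x y (- y) ⟩
    x + (y + - y)  ≈⟨ +-congˡ (-‿inverseʳ y) ⟩
    x + 0#         ≈⟨ +-identityʳ x ⟩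
    x              ∎

  cancel′ : ∀ x y → (x + - y) + y ≈ x
  cancel′ x y = begin
    (x + - y) + y  ≈⟨ +-assoc x (- y) y ⟩
    x + (- y + y)  ≈⟨ +-congˡ (-‿inverseˡ y) ⟩
    x + 0#         ≈⟨ +-identityʳ x ⟩
    x              ∎

  0≤y-x : ∀ {x y} → x ≤ y → 0# ≤ y + - x
  0≤y-x {x} p = ≤-resp (-‿inverseʳ x) refl (+-monoˡ-≤ (- x) p)

  *-monoʳ-≤ : ∀ {x y} z → 0# ≤ z → x ≤ y → z * x ≤ z * y
  *-monoʳ-≤ {x} {y} z 0≤z x≤y =
    ≤-resp (+-identityˡ _) eq
      (+-monoˡ-≤ (z * x) (*-nonNeg 0≤z (0≤y-x x≤y)))
    where
    eq : z * (y + - x) + z * x ≈ z * y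
    eq = begin
      z * (y + - x) + z * x  ≈⟨ sym (distribˡ z _ x) ⟩
      z * ((y + - x) + x)    ≈⟨ *-congˡ (cancel′ y x) ⟩
      z * y                  ∎

  0≤1 : 0# ≤ 1#
  0≤1 with ≤-total 0# 1#
  ... | inj₁ p = p
  ... | inj₂ p = ≤-resp refl eq (*-nonNeg q q)
    where
    q : 0# ≤ - 1#
    q = ≤-resp refl (+-identityˡ (- 1#)) (0≤y-x p)

    eq : - 1# * - 1# ≈ 1#
    eq = begin
      - 1# * - 1#    ≈⟨ -1*x≈-x (- 1#) ⟩
      - (- 1#)       ≈⟨ -‿involutive 1# ⟩
      1#             ∎

  x≤x*y : ∀ {x y} → 0# ≤ x → 1# ≤ y → x ≤ x * y
  x≤x*y {x} 0≤x 1≤y = ≤-resp (*-identityʳ x) refl (*-monoʳ-≤ x 0≤x 1≤y)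

  1≤x*y : ∀ {x y} → 1# ≤ x → 1# ≤ y → 1# ≤ x * y
  1≤x*y 1≤x 1≤y = ≤-trans 1≤x (x≤x*y (≤-trans 0≤1 1≤x) 1≤y)

  1≤x^n : ∀ {x} n → 1# ≤ x → 1# ≤ x ^ n
  1≤x^n zero    _   = ≤-refl
  1≤x^n (suc n) 1≤x = 1≤x*y 1≤x (1≤x^n n 1≤x)

  0≤ℕ⇒ℝ : ∀ n → 0# ≤ ℕ⇒ℝ n
  0≤ℕ⇒ℝ zero    = ≤-refl
  0≤ℕ⇒ℝ (suc n) =
    ≤-trans 0≤1 (≤-resp (+-identityʳ 1#) refl (+-monoʳ-≤ 1# (0≤ℕ⇒ℝ n)))

  1≤ℕ⇒ℝ : ∀ t .{{_ : NonZero t}} → 1# ≤ ℕ⇒ℝ t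
  1≤ℕ⇒ℝ (suc t) = ≤-resp (+-identityʳ 1#) refl (+-monoʳ-≤ 1# (0≤ℕ⇒ℝ t))

  1≰0 : ¬ (1# ≤ 0#)
  1≰0 p = 1≉0 (≤-antisym p 0≤1)

  archimedean : ∀ x → ∃ λ n → x ≤ ℕ⇒ℝ n
  archimedean x with em {∃ λ n → x ≤ ℕ⇒ℝ n}
  ... | yes p = p
  ... | no ¬p = ⊥-elim (1≰0 1≤0)
    where
    IsNat : Pred ℝ 0ℓ
    IsNat y = ∃ λ n → y ≈ ℕ⇒ℝ n

    x-bounds : IsUpperBound IsNat x
    x-bounds y (n , y≈n) with ≤-total y x
    ... | inj₁ y≤x = y≤x
    ... | inj₂ x≤y = ⊥-elim (¬p (n , ≤-resp refl y≈n x≤y))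

    sup : ∃ (IsSupremum IsNat)
    sup = complete IsNat (0# , 0 , refl) (x , x-bounds)

    s : ℝ
    s = proj₁ sup

    s-1-bounds : IsUpperBound IsNat (s + - 1#)
    s-1-bounds y (n , y≈n) =
      ≤-resp (trans (+-congʳ (+-comm 1# (ℕ⇒ℝ n))) (trans (cancel _ 1#) (sym y≈n)))
             refl
             (+-monoˡ-≤ (- 1#) (proj₁ (proj₂ sup) _ (suc n , refl)))

    1≤0 : 1# ≤ 0#
    1≤0 = ≤-resp (trans (+-congʳ (+-comm s 1#)) (cancel 1# s))
                 (-‿inverseʳ s)
                 (+-monoˡ-≤ (- s)
                   (≤-resp refl (cancel′ s 1#)
                     (+-monoˡ-≤ 1# (proj₂ (proj₂ sup) _ s-1-bounds))))

  -- For y ≥ 0 the inequality y ^ k * t ^ m ≤ 1 says y ≤ t ^ (- m / k).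
  BelowPower : ℕ → ℝ → Pred ℝ 0ℓ
  BelowPower t u y = 0# ≤ y ∧ ∃ λ m → ∃ λ k →
    NonZero k ∧ ℕ⇒ℝ k * u ≤ ℕ⇒ℝ m ∧ y ^ k * ℕ⇒ℝ t ^ m ≤ 1#

  BelowPower-inhabited : ∀ t u → ∃ (BelowPower t u)
  BelowPower-inhabited t u =
    let (m , u≤m) = archimedean u in
    0# , ≤-refl , m , 1 , _ ,
    ≤-resp (sym (trans (*-congʳ (+-identityʳ 1#)) (*-identityˡ u))) refl u≤m ,
    ≤-resp (sym (trans (*-congʳ (zeroˡ 1#)) (zeroˡ _))) refl 0≤1

  BelowPower-bounded : ∀ t .{{_ : NonZero t}} u → ∃ (IsUpperBound (BelowPower t u))
  BelowPower-bounded t u = 1# , bound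
    where
    bound : IsUpperBound (BelowPower t u) 1#
    bound y (0≤y , m , suc k , _ , _ , le) with ≤-total y 1#
    ... | inj₁ y≤1 = y≤1
    ... | inj₂ 1≤y = ≤-trans (x≤x*y 0≤y (1≤x^n k 1≤y))
      (≤-trans (x≤x*y (≤-trans 0≤1 (1≤x^n (suc k) 1≤y))
                      (1≤x^n m (1≤ℕ⇒ℝ t))) le)

  -- For real u > 0, t ^- u is t ^ (- u), the supremum of t ^ (- r) over
  -- the rational numbers r ≥ u.
  _^-_ : (t : ℕ) .{{_ : NonZero t}} → ℝ → ℝ
  t ^- u = proj₁ (complete (BelowPower t u) (BelowPower-inhabited t u) (BelowPower-bounded t u))

  ^-‿isSupremum : ∀ t .{{_ : NonZero t}} u → IsSupremum (BelowPower t u) (t ^- u)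
  ^-‿isSupremum t u = proj₂ (complete (BelowPower t u) (BelowPower-inhabited t u) (BelowPower-bounded t u))

  SquareBelow : ℝ → Pred ℝ 0ℓ
  SquareBelow c y = y * y ≤ c

  SquareBelow-bounded : ∀ c → 0# ≤ c → ∃ (IsUpperBound (SquareBelow c))
  SquareBelow-bounded c 0≤c = 1# + c , bound
    where
    1≤1+c : 1# ≤ 1# + c
    1≤1+c = ≤-resp (+-identityʳ 1#) refl (+-monoʳ-≤ 1# 0≤c)

    c≤1+c : c ≤ 1# + c
    c≤1+c = ≤-resp (+-identityˡ c) refl (+-monoˡ-≤ c 0≤1)

    bound : IsUpperBound (SquareBelow c) (1# + c)
    bound y y²≤c with ≤-total y (1# + c)
    ... | inj₁ p = p
    ... | inj₂ p = ≤-trans (x≤x*y (≤-trans 0≤1 1≤y) 1≤y) (≤-trans y²≤c c≤1+c)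
      where
      1≤y : 1# ≤ y
      1≤y = ≤-trans 1≤1+c p

  0≤x² : ∀ x → 0# ≤ x * x
  0≤x² x with ≤-total 0# x
  ... | inj₁ p = *-nonNeg p p
  ... | inj₂ p = ≤-resp refl eq (*-nonNeg q q)
    where
    q : 0# ≤ - x
    q = ≤-resp refl (+-identityˡ (- x)) (0≤y-x p)

    eq : - x * - x ≈ x * x
    eq = begin
      - x * - x      ≈⟨ sym (-‿distribˡ-* x (- x)) ⟩
      - (x * - x)    ≈⟨ -‿cong (sym (-‿distribʳ-* x x)) ⟩
      - - (x * x)    ≈⟨ -‿involutive (x * x) ⟩
      x * x          ∎

  0≤x+y : ∀ {x y} → 0# ≤ x → 0# ≤ y → 0# ≤ x + y
  0≤x+y 0≤x 0≤y = ≤-trans 0≤x (≤-resp (+-identityʳ _) refl (+-monoʳ-≤ _ 0≤y))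

  0≤x·x : ∀ {n} (x : Vector ℝ n) → 0# ≤ x · x
  0≤x·x {zero}  x = ≤-refl
  0≤x·x {suc n} x = 0≤x+y (0≤x² (x zero)) (0≤x·x (tail x))

  0≤1+x·x : ∀ {n} (x : Vector ℝ n) → 0# ≤ 1# + x · x
  0≤1+x·x x = 0≤x+y 0≤1 (0≤x·x x)

  sqrt : (c : ℝ) → 0# ≤ c → ℝ
  sqrt c 0≤c = proj₁ (complete (SquareBelow c)
    (0# , ≤-resp (sym (zeroˡ 0#)) refl 0≤c) (SquareBelow-bounded c 0≤c))

  sqrt-isSupremum : ∀ c (0≤c : 0# ≤ c) → IsSupremum (SquareBelow c) (sqrt c 0≤c)
  sqrt-isSupremum c 0≤c = proj₂ (complete (SquareBelow c)
    (0# , ≤-resp (sym (zeroˡ 0#)) refl 0≤c) (SquareBelow-bounded c 0≤c))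

  -- A column (α₀ , … , αₙ₋₁) of M_{n,1} is a Vector ℝ n.

  𝒲 : (n : ℕ) (v : ℝ) → Pred (Vector ℝ n) 0ℓ
  𝒲 n v α = InfinitelyMany λ (q : ℤ) →
    Σ (q ≢ ℤ.0ℤ) λ q≢0 → ∃ λ (p : Vector ℤ n) →
      maxNorm (λ i → ℤ⇒ℝ (p i) + α i * ℤ⇒ℝ q)
        < _^-_ ℤ.∣ q ∣ {{≢-nonZero λ eq → q≢0 (ℤₚ.∣i∣≡0⇒i≡0 eq)}} v

  𝒲⁻ : (n : ℕ) (v : ℝ) → Pred (Vector ℝ n) 0ℓ
  𝒲⁻ n v α = ∀ u → 0# < u → u < v → 𝒲 n u α

  -- Here the ambient dimension is n = suc d, so that x ranges over
  -- ℝⁿ⁻¹ = Vector ℝ d.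

  graph : ∀ {d} → Vector ℝ (suc d) → Vector ℝ d → Vector ℝ (suc d)
  graph {d} α x = insertAt x (fromℕ d) ((1# ∷ x) · α)

  Hyperplane : ∀ {d} → Vector ℝ (suc d) → Pred (Vector ℝ (suc d)) 0ℓ
  Hyperplane α y = ∃ λ x → y ≋ graph α x

  ℒ : ∀ {n} → Pred (Vector ℝ n) 0ℓ → (ℕ → ℝ) → Pred (Vector ℝ n) 0ℓ
  ℒ {n} M ψ y = M y ∧ InfinitelyMany λ (q : Vec ℤ n) → ∃ λ (p : ℤ) →
    ∣ ℤ⇒ℝ p + y · (λ i → ℤ⇒ℝ (lookup q i)) ∣ < ψ ‖ q ‖

  record Box (d : ℕ) : Set where
    field
      lower upper : Vector ℝ d
      lower≤upper : ∀ i → lower i ≤ upper i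

    _∋_ : Pred (Vector ℝ d) 0ℓ
    _∋_ x = ∀ i → lower i ≤ x i ∧ x i ≤ upper i

    volume : ℝ
    volume = product (λ i → upper i + - lower i)

  -- A member of a covering may be the empty set, encoded by nothing.
  -- This matters for d = 0, where every box has volume 1.

  Patch : ∀ {d} → Vector ℝ (suc d) → Maybe (Box d) → Pred (Vector ℝ (suc d)) 0ℓ
  Patch α nothing  y = ⊥
  Patch α (just B) y = ∃ λ x → Box._∋_ B x ∧ y ≋ graph α x

  -- The Gram determinant of the affine chart x ↦ graph α x is
  -- 1 + α₁² + ⋯ + α_d².
  patchVolume : ∀ {d} → Vector ℝ (suc d) → Maybe (Box d) → ℝ
  patchVolume α nothing  = 0#
  patchVolume α (just B) =
    sqrt (1# + tail α · tail α) (0≤1+x·x (tail α)) * Box.volume B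

  -- S ⊆ Hyperplane α has volume zero when it has countable coverings by
  -- patches of arbitrarily small total volume.  All terms are
  -- nonnegative, so the total is bounded through the partial sums.
  VolumeZero : ∀ {d} → Vector ℝ (suc d) → Pred (Vector ℝ (suc d)) 0ℓ → Set
  VolumeZero {d} α S = ∀ ε → 0# < ε →
    ∃ λ (B : ℕ → Maybe (Box d)) →
      (∀ y → S y → ∃ λ k → Patch α (B k) y) ∧
      (∀ N → partialSum (λ k → patchVolume α (B k)) N ≤ ε)

{-# OPTIONS --safe #-}

-- In the coordinate x of the chart, y · q + p becomes the affine form
-- (1, x) · v with coefficient vector v = (pᵢ + αᵢ q)ᵢ, where q is the last
-- entry of the integer vector and the pᵢ are p and its remaining entries.
-- A slab |(1, x) · v| ≤ w inside a cube has volume of order w / ‖v‖ (and is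
-- empty if n = 1), provided w is small compared with ‖v‖.
--
-- The hypothesis on α gives ‖v‖ ≥ 1 / (C |q|ⁿ) for q ≠ 0.  Two different v
-- with |q - q′| < 2ˢ are therefore at distance at least of order 2⁻ⁿˢ, so a
-- block of 2ˢ consecutive values of q contains at most one v shorter than
-- this.  Halving the blocks repeatedly bounds the cost g(s) of a block, up to
-- constants, by g(s + 1) ≤ 2 g(s) + w 2ⁿˢ, and since n ≥ 2 the slabs with
-- |q|, |pᵢ| ≤ N have total volume O(w Nⁿ).  With w = ψ(2ᵗ⁺¹) and N = 2ᵗ⁺² these
-- bounds are summable by Cauchy condensation, and Borel–Cantelli applies.
module Submission where

open import Defs
open import Axiom.ExcludedMiddle using (ExcludedMiddle)
open import Data.Nat.Base as ℕ using (ℕ; suc)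
open import Data.Vec.Functional using (Vector)
open import Level using (0ℓ)
open import Relation.Nullary using (¬_)

import Algebra.Construct.NaturalChoice.Max as Max
import Algebra.Properties.AbelianGroup as AbelianGroupProperties
import Algebra.Properties.CommutativeMonoid.Sum as SumProperties
import Algebra.Properties.Monoid.Mult as MonoidMult
import Algebra.Properties.Ring as RingProperties
import Algebra.Properties.Semiring.Mult as Mult
import Algebra.Solver.Ring as RingSolver
open import Algebra.Solver.Ring.AlmostCommutativeRing
  using (AlmostCommutativeRing; fromCommutativeRing; _-Raw-AlmostCommutative⟶_)
open import Data.Empty using (⊥-elim)
open import Data.Fin.Base as Fin using (Fin; zero; suc; toℕ; fromℕ; punchIn)
import Data.Fin.Properties as Finₚ
open import Data.Integer.Base as ℤ using (ℤ; +_; -[1+_])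
import Data.Integer.Properties as ℤₚ
open import Data.Integer.Tactic.RingSolver using () renaming (solve-∀ to ℤ-solve-∀)
open import Data.List.Base as List using (List; []; _∷_; _++_)
open import Data.List.Membership.Propositional using (_∈_)
open import Data.List.Membership.Propositional.Properties
  using (∈-++⁺ˡ; ∈-++⁺ʳ; ∈-map⁺; ∈-upTo⁺; ∈-cartesianProductWith⁺)
open import Data.List.Relation.Unary.Any as Any using (Any; here; there)
import Data.List.Relation.Unary.Any.Properties as Anyₚ
open import Data.Maybe.Base using (Maybe; just; nothing)
open import Data.Nat.Base using (zero; z≤n; s≤s; ≢-nonZero)
import Data.Nat.Properties as ℕₚ
open import Data.Nat.Tactic.RingSolver using () renaming (solve-∀ to ℕ-solve-∀)
open import Data.Product.Base using (∃; _,_; proj₁; proj₂) renaming (_×_ to _∧_)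
open import Data.Sum.Base using (_⊎_; inj₁; inj₂)
open import Data.Vec.Base as Vec using (Vec; lookup)
open import Data.Vec.Functional as Vector using (tail; insertAt; removeAt) renaming (_∷_ to _◂_)
import Data.Vec.Functional.Properties as Vectorₚ
open import Function.Base using (_∘_; case_of_)
open import Relation.Binary.PropositionalEquality.Core as ≡ using (_≡_; _≢_; _≗_)
import Relation.Binary.Reasoning.Setoid as SetoidReasoning
open import Relation.Binary.Structures using (IsTotalOrder)
open import Relation.Nullary using (yes; no)
open import Relation.Unary using (Pred)

-- The obstacle is a single very short vector: `‖v‖` may be of order `N ^ (- n)`, and then its slab
-- alone costs about `w N ^ n`, the whole budget of the level. Long vectors are harmless: there are
-- about `N ^ n` choices of `q` and of the `pᵢ` other than the constant term, and each choice, with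
-- all its constant terms, costs `O(w)`. So the short vectors have to be rationed by block length.
-- When the length is halved, twice as many blocks may contain a short vector, but the cost of each
-- drops by the factor `2 ^ n`; the sum over all lengths is dominated by the longest block once
-- `n ≥ 2`. For `n = 1` the same count would lose a logarithm.
--
-- Volume is handled only through finite lists of boxes with a bound on their total, so every
-- estimate is a union bound. The constants depend on the cube; Borel-Cantelli is therefore prepared
-- for each cube separately and the coverings are merged afterwards. Slabs are covered only for
-- `w > 0`, so a `ψ` with a nonpositive value at some `k ≥ 1` is set aside beforehand.

module Khintchine (em : ExcludedMiddle 0ℓ) (R : RealField) where
  open RealAnalysis em R
  open IsTotalOrder isTotalOrder using ()
    renaming ( refl to ≤-refl; reflexive to ≤-reflexive; trans to ≤-trans
             ; antisym to ≤-antisym; total to ≤-total )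
  open RingProperties ring using (-‿involutive; -‿distribˡ-*; -‿distribʳ-*; -0#≈0#)
  open AbelianGroupProperties +-abelianGroup using (⁻¹-∙-comm)
  open Mult semiring using (×1-homo-*)
  open MonoidMult +-monoid using (×-homo-+)
  open SumProperties +-commutativeMonoid using (sum-cong-≋; ∑-comm; sum-remove)
  module MaxP = Max ≤-totalOrder

  -- Ordered-field arithmetic and the embedding of the integers

  ℕ⇒ℝ-+ : ∀ m n → ℕ⇒ℝ (m ℕ.+ n) ≈ ℕ⇒ℝ m + ℕ⇒ℝ n
  ℕ⇒ℝ-+ = ×-homo-+ 1#

  ℕ⇒ℝ-* : ∀ m n → ℕ⇒ℝ (m ℕ.* n) ≈ ℕ⇒ℝ m * ℕ⇒ℝ n
  ℕ⇒ℝ-* = ×1-homo-*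

  ℕ⇒ℝ-^ : ∀ m k → ℕ⇒ℝ (m ℕ.^ k) ≈ ℕ⇒ℝ m ^ k
  ℕ⇒ℝ-^ m zero    = +-identityʳ 1#
  ℕ⇒ℝ-^ m (suc k) = trans (ℕ⇒ℝ-* m (m ℕ.^ k)) (*-congˡ (ℕ⇒ℝ-^ m k))

  ℕ⇒ℝ-cong : ∀ {m n} → m ≡ n → ℕ⇒ℝ m ≈ ℕ⇒ℝ n
  ℕ⇒ℝ-cong ≡.refl = refl

  ℤ⇒ℝ-neg : ∀ i → ℤ⇒ℝ (ℤ.- i) ≈ - ℤ⇒ℝ i
  ℤ⇒ℝ-neg (+ zero)  = sym -0#≈0#
  ℤ⇒ℝ-neg (+ suc n) = refl
  ℤ⇒ℝ-neg -[1+ n ]  = sym (-‿involutive _)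

  ℤ⇒ℝ-⊖ : ∀ m n → ℤ⇒ℝ (m ℤ.⊖ n) ≈ ℕ⇒ℝ m + - ℕ⇒ℝ n
  ℤ⇒ℝ-⊖ m       zero    = sym (trans (+-congˡ -0#≈0#) (+-identityʳ _))
  ℤ⇒ℝ-⊖ zero    (suc n) = sym (+-identityˡ _)
  ℤ⇒ℝ-⊖ (suc m) (suc n) = begin
    ℤ⇒ℝ (suc m ℤ.⊖ suc n)            ≡⟨ ≡.cong ℤ⇒ℝ (ℤₚ.[1+m]⊖[1+n]≡m⊖n m n) ⟩
    ℤ⇒ℝ (m ℤ.⊖ n)                    ≈⟨ ℤ⇒ℝ-⊖ m n ⟩
    a + - b                          ≈⟨ +-congʳ (sym (cancel a 1#)) ⟩
    ((a + 1#) + - 1#) + - b          ≈⟨ +-assoc _ _ _ ⟩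
    (a + 1#) + (- 1# + - b)          ≈⟨ +-cong (+-comm a 1#) (⁻¹-∙-comm 1# b) ⟩
    (1# + a) + - (1# + b)            ∎
    where
    open SetoidReasoning setoid
    a = ℕ⇒ℝ m
    b = ℕ⇒ℝ n

  ℤ⇒ℝ-+ : ∀ i j → ℤ⇒ℝ (i ℤ.+ j) ≈ ℤ⇒ℝ i + ℤ⇒ℝ j
  ℤ⇒ℝ-+ (+ m)    (+ n)    = ℕ⇒ℝ-+ m n
  ℤ⇒ℝ-+ (+ m)    -[1+ n ] = ℤ⇒ℝ-⊖ m (suc n)
  ℤ⇒ℝ-+ -[1+ m ] (+ n)    = trans (ℤ⇒ℝ-⊖ n (suc m)) (+-comm _ _)
  ℤ⇒ℝ-+ -[1+ m ] -[1+ n ] = begin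
    - ℕ⇒ℝ (suc (suc (m ℕ.+ n)))        ≡⟨ ≡.cong (λ k → - ℕ⇒ℝ (suc k)) (≡.sym (ℕₚ.+-suc m n)) ⟩
    - ℕ⇒ℝ (suc m ℕ.+ suc n)            ≈⟨ -‿cong (ℕ⇒ℝ-+ (suc m) (suc n)) ⟩
    - (ℕ⇒ℝ (suc m) + ℕ⇒ℝ (suc n))      ≈⟨ sym (⁻¹-∙-comm _ _) ⟩
    - ℕ⇒ℝ (suc m) + - ℕ⇒ℝ (suc n)      ∎
    where open SetoidReasoning setoid

  ℤ⇒ℝ-* : ∀ i j → ℤ⇒ℝ (i ℤ.* j) ≈ ℤ⇒ℝ i * ℤ⇒ℝ j
  ℤ⇒ℝ-* (+ m) j = pos m
    where
    open SetoidReasoning setoid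
    pos : ∀ m → ℤ⇒ℝ (+ m ℤ.* j) ≈ ℕ⇒ℝ m * ℤ⇒ℝ j
    pos zero    = trans (reflexive (≡.cong ℤ⇒ℝ (ℤₚ.*-zeroˡ j))) (sym (zeroˡ _))
    pos (suc m) = begin
      ℤ⇒ℝ (+ suc m ℤ.* j)          ≡⟨ ≡.cong ℤ⇒ℝ (ℤₚ.suc-* (+ m) j) ⟩
      ℤ⇒ℝ (j ℤ.+ + m ℤ.* j)        ≈⟨ ℤ⇒ℝ-+ j (+ m ℤ.* j) ⟩
      ℤ⇒ℝ j + ℤ⇒ℝ (+ m ℤ.* j)      ≈⟨ +-cong (sym (*-identityˡ _)) (pos m) ⟩
      1# * ℤ⇒ℝ j + ℕ⇒ℝ m * ℤ⇒ℝ j   ≈⟨ sym (distribʳ _ _ _) ⟩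
      (1# + ℕ⇒ℝ m) * ℤ⇒ℝ j         ∎
  ℤ⇒ℝ-* -[1+ m ] j = begin
    ℤ⇒ℝ (-[1+ m ] ℤ.* j)            ≡⟨ ≡.cong ℤ⇒ℝ (≡.sym (ℤₚ.neg-distribˡ-* (+ suc m) j)) ⟩
    ℤ⇒ℝ (ℤ.- (+ suc m ℤ.* j))       ≈⟨ ℤ⇒ℝ-neg (+ suc m ℤ.* j) ⟩
    - ℤ⇒ℝ (+ suc m ℤ.* j)           ≈⟨ -‿cong (ℤ⇒ℝ-* (+ suc m) j) ⟩
    - (ℕ⇒ℝ (suc m) * ℤ⇒ℝ j)         ≈⟨ -‿distribˡ-* _ _ ⟩
    - ℕ⇒ℝ (suc m) * ℤ⇒ℝ j           ∎
    where open SetoidReasoning setoid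

  acr : AlmostCommutativeRing 0ℓ 0ℓ
  acr = fromCommutativeRing commutativeRing

  -- ℤ⇒ℝ (+ 1) is 1# + 0#; sending + 1 to 1# itself lets the literal 1# occur
  -- in the identities given to the solver.
  coefficient : ℤ → ℝ
  coefficient (+ 1) = 1#
  coefficient i     = ℤ⇒ℝ i

  coefficient≈ : ∀ i → coefficient i ≈ ℤ⇒ℝ i
  coefficient≈ (+ 0)           = refl
  coefficient≈ (+ 1)           = sym (+-identityʳ 1#)
  coefficient≈ (+ suc (suc n)) = refl
  coefficient≈ -[1+ n ]        = refl

  coefficient-morphism : ℤ.+-*-rawRing -Raw-AlmostCommutative⟶ acr
  coefficient-morphism = record
    { ⟦_⟧    = coefficient
    ; +-homo = λ i j → trans (coefficient≈ (i ℤ.+ j)) (trans (ℤ⇒ℝ-+ i j)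
                 (sym (+-cong (coefficient≈ i) (coefficient≈ j))))
    ; *-homo = λ i j → trans (coefficient≈ (i ℤ.* j)) (trans (ℤ⇒ℝ-* i j)
                 (sym (*-cong (coefficient≈ i) (coefficient≈ j))))
    ; -‿homo = λ i → trans (coefficient≈ (ℤ.- i)) (trans (ℤ⇒ℝ-neg i) (sym (-‿cong (coefficient≈ i))))
    ; 0-homo = refl
    ; 1-homo = refl
    }

  coefficient≟ : ∀ i j → Maybe (coefficient i ≈ coefficient j)
  coefficient≟ i j with i ℤₚ.≟ j
  ... | yes i≡j = just (reflexive (≡.cong coefficient i≡j))
  ... | no  _   = nothing

  open RingSolver ℤ.+-*-rawRing acr coefficient-morphism coefficient≟ public
    using (solve; _:+_; _:*_; :-_; _:=_; con; Polynomial)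

  :0 :1 :2 : ∀ {n} → Polynomial n
  :0 = con (+ 0)
  :1 = con (+ 1)
  :2 = con (+ 2)

  2# : ℝ
  2# = ℕ⇒ℝ 2

  -- Linear arithmetic by certificate: known inequalities are added up to `l ≤ r`, and a ring
  -- identity, usually left to the solver, says that `y` minus `x` equals `r` minus `l`.
  lin : ∀ {x y l r} → l ≤ r → x + r ≈ y + l → x ≤ y
  lin {x} {y} {l} {r} l≤r eq =
    ≤-resp (trans (+-congʳ (sym eq)) (cancel x r)) (cancel y r) (+-monoˡ-≤ (- r) (+-monoʳ-≤ y l≤r))

  +-mono-≤ : ∀ {x y x′ y′} → x ≤ y → x′ ≤ y′ → x + x′ ≤ y + y′
  +-mono-≤ p q = ≤-trans (+-monoˡ-≤ _ p) (+-monoʳ-≤ _ q)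

  *-monoˡ-≤ : ∀ {x y} z → 0# ≤ z → x ≤ y → x * z ≤ y * z
  *-monoˡ-≤ z 0≤z p = ≤-resp (*-comm z _) (*-comm z _) (*-monoʳ-≤ z 0≤z p)

  *-mono-≤ : ∀ {x y x′ y′} → 0# ≤ y → 0# ≤ x′ → x ≤ y → x′ ≤ y′ → x * x′ ≤ y * y′
  *-mono-≤ 0≤y 0≤x′ p q = ≤-trans (*-monoˡ-≤ _ 0≤x′ p) (*-monoʳ-≤ _ 0≤y q)

  x≤x+y : ∀ {x y} → 0# ≤ y → x ≤ x + y
  x≤x+y 0≤y = ≤-resp (+-identityʳ _) refl (+-monoʳ-≤ _ 0≤y)

  neg-mono-≤ : ∀ {x y} → x ≤ y → - y ≤ - x
  neg-mono-≤ {x} {y} p = lin p (solve 2 (λ x y → :- y :+ y := :- x :+ x) refl x y)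

  ≰⇒≥ : ∀ {x y} → ¬ (x ≤ y) → y ≤ x
  ≰⇒≥ {x} {y} ¬p with ≤-total x y
  ... | inj₁ p = ⊥-elim (¬p p)
  ... | inj₂ p = p

  ≰⇒> : ∀ {x y} → ¬ (x ≤ y) → y < x
  ≰⇒> ¬p = ≰⇒≥ ¬p , λ eq → ¬p (≤-reflexive (sym eq))

  <⇒≱ : ∀ {x y} → x < y → ¬ (y ≤ x)
  <⇒≱ (x≤y , x≉y) y≤x = x≉y (≤-antisym x≤y y≤x)

  ≮⇒≥ : ∀ {x y} → ¬ (x < y) → y ≤ x
  ≮⇒≥ {x} {y} ¬p with em {y ≤ x}
  ... | yes p = p
  ... | no ¬q = ⊥-elim (¬p (≰⇒> ¬q))

  0<1 : 0# < 1#
  0<1 = ≰⇒> 1≰0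

  <-≤-trans : ∀ {x y z} → x < y → y ≤ z → x < z
  <-≤-trans x<y y≤z = ≰⇒> λ z≤x → <⇒≱ x<y (≤-trans y≤z z≤x)

  ≤-<-trans : ∀ {x y z} → x ≤ y → y < z → x < z
  ≤-<-trans x≤y y<z = ≰⇒> λ z≤x → <⇒≱ y<z (≤-trans z≤x x≤y)

  0<ℕ⇒ℝ : ∀ n .{{_ : ℕ.NonZero n}} → 0# < ℕ⇒ℝ n
  0<ℕ⇒ℝ n = <-≤-trans 0<1 (1≤ℕ⇒ℝ n)

  positive-inverse : ∀ {x} → 0# < x → ∃ λ y → 0# ≤ y ∧ x * y ≈ 1#
  positive-inverse {x} (0≤x , 0≉x) with inverse x (λ eq → 0≉x (sym eq))
  ... | y , xy≈1 with ≤-total 0# y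
  ...   | inj₁ 0≤y = y , 0≤y , xy≈1
  ...   | inj₂ y≤0 = ⊥-elim (1≰0 (≤-resp xy≈1 (zeroʳ x) (*-monoʳ-≤ x 0≤x y≤0)))

  *-cancelˡ-≤ : ∀ {x y z} → 0# < z → z * x ≤ z * y → x ≤ y
  *-cancelˡ-≤ {x} {y} {z} 0<z zx≤zy with positive-inverse 0<z
  ... | u , 0≤u , zu≈1 = ≤-resp (eq x) (eq y) (*-monoʳ-≤ u 0≤u zx≤zy)
    where
    eq : ∀ t → u * (z * t) ≈ t
    eq t = trans (sym (*-assoc u z t)) (trans (*-congʳ (trans (*-comm u z) zu≈1)) (*-identityˡ t))

  *-pos : ∀ {x y} → 0# < x → 0# < y → 0# < x * y
  *-pos {x} {y} 0<x 0<y = ≰⇒> λ xy≤0 →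
    <⇒≱ 0<y (*-cancelˡ-≤ 0<x (≤-resp refl (sym (zeroʳ x)) xy≤0))

  ^-nonNeg : ∀ {x} k → 0# ≤ x → 0# ≤ x ^ k
  ^-nonNeg zero    p = 0≤1
  ^-nonNeg (suc k) p = *-nonNeg p (^-nonNeg k p)

  ℕ⇒ℝ-mono : ∀ {m n} → m ℕ.≤ n → ℕ⇒ℝ m ≤ ℕ⇒ℝ n
  ℕ⇒ℝ-mono {n = n} z≤n = 0≤ℕ⇒ℝ n
  ℕ⇒ℝ-mono (s≤s p)     = +-monoʳ-≤ 1# (ℕ⇒ℝ-mono p)

  ℕ⇒ℝ-reflects-≤ : ∀ m n → ℕ⇒ℝ m ≤ ℕ⇒ℝ n → m ℕ.≤ n
  ℕ⇒ℝ-reflects-≤ zero    n       p = z≤n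
  ℕ⇒ℝ-reflects-≤ (suc m) zero    p = ⊥-elim (1≰0 (≤-trans (1≤ℕ⇒ℝ (suc m)) p))
  ℕ⇒ℝ-reflects-≤ (suc m) (suc n) p =
    s≤s (ℕ⇒ℝ-reflects-≤ m n (lin p (solve 2 (λ x y → x :+ (:1 :+ y) := y :+ (:1 :+ x)) refl (ℕ⇒ℝ m) (ℕ⇒ℝ n))))

  -- Absolute value and maximum norm

  x≤∣x∣ : ∀ x → x ≤ ∣ x ∣
  x≤∣x∣ x = MaxP.x≤x⊔y x (- x)

  -x≤∣x∣ : ∀ x → - x ≤ ∣ x ∣
  -x≤∣x∣ x = MaxP.x≤y⊔x x (- x)

  ∣∣-least : ∀ {x b} → x ≤ b → - x ≤ b → ∣ x ∣ ≤ b
  ∣∣-least = MaxP.⊔-lub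

  ∣∣-cong : ∀ {x y} → x ≈ y → ∣ x ∣ ≈ ∣ y ∣
  ∣∣-cong eq = MaxP.⊔-cong eq (-‿cong eq)

  0≤∣x∣ : ∀ x → 0# ≤ ∣ x ∣
  0≤∣x∣ x with ≤-total 0# x
  ... | inj₁ 0≤x = ≤-trans 0≤x (x≤∣x∣ x)
  ... | inj₂ x≤0 = ≤-trans (≤-resp -0#≈0# refl (neg-mono-≤ x≤0)) (-x≤∣x∣ x)

  ∣x+y∣≤ : ∀ x y → ∣ x + y ∣ ≤ ∣ x ∣ + ∣ y ∣
  ∣x+y∣≤ x y = ∣∣-least (+-mono-≤ (x≤∣x∣ x) (x≤∣x∣ y))
    (≤-resp (⁻¹-∙-comm x y) refl (+-mono-≤ (-x≤∣x∣ x) (-x≤∣x∣ y)))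

  ∣-x∣ : ∀ x → ∣ - x ∣ ≈ ∣ x ∣
  ∣-x∣ x = ≤-antisym
    (∣∣-least (-x≤∣x∣ x) (≤-resp (sym (-‿involutive x)) refl (x≤∣x∣ x)))
    (∣∣-least (≤-resp (-‿involutive x) refl (-x≤∣x∣ (- x))) (x≤∣x∣ (- x)))

  ∣∣-sign : ∀ x → (0# ≤ x ∧ ∣ x ∣ ≈ x) ⊎ (x ≤ 0# ∧ ∣ x ∣ ≈ - x)
  ∣∣-sign x with ≤-total 0# x
  ... | inj₁ 0≤x = inj₁ (0≤x , ≤-antisym (∣∣-least ≤-refl
        (≤-trans (≤-resp refl -0#≈0# (neg-mono-≤ 0≤x)) 0≤x)) (x≤∣x∣ x))
  ... | inj₂ x≤0 = inj₂ (x≤0 , ≤-antisym (∣∣-least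
        (≤-trans x≤0 (≤-resp -0#≈0# refl (neg-mono-≤ x≤0))) ≤-refl) (-x≤∣x∣ x))

  ∣x*y∣-nonNeg : ∀ x {y} → 0# ≤ y → ∣ x * y ∣ ≈ ∣ x ∣ * y
  ∣x*y∣-nonNeg x {y} 0≤y = ≤-antisym
    (∣∣-least (*-monoˡ-≤ y 0≤y (x≤∣x∣ x))
              (≤-resp (sym (-‿distribˡ-* x y)) refl (*-monoˡ-≤ y 0≤y (-x≤∣x∣ x))))
    (case ∣∣-sign x of λ where
      (inj₁ (_ , e)) → ≤-resp (*-congʳ (sym e)) refl (x≤∣x∣ (x * y))
      (inj₂ (_ , e)) → ≤-resp (trans (-‿distribˡ-* x y) (*-congʳ (sym e))) refl (-x≤∣x∣ (x * y)))

  ∣x*y∣ : ∀ x y → ∣ x * y ∣ ≈ ∣ x ∣ * ∣ y ∣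
  ∣x*y∣ x y with ∣∣-sign y
  ... | inj₁ (0≤y , eq) = trans (∣x*y∣-nonNeg x 0≤y) (*-congˡ (sym eq))
  ... | inj₂ (y≤0 , eq) = begin
      ∣ x * y ∣         ≈⟨ sym (∣-x∣ (x * y)) ⟩
      ∣ - (x * y) ∣     ≈⟨ ∣∣-cong (-‿distribʳ-* x y) ⟩
      ∣ x * - y ∣       ≈⟨ ∣x*y∣-nonNeg x (≤-resp -0#≈0# refl (neg-mono-≤ y≤0)) ⟩
      ∣ x ∣ * - y       ≈⟨ *-congˡ (sym eq) ⟩
      ∣ x ∣ * ∣ y ∣     ∎
    where open SetoidReasoning setoid

  ∣ℤ⇒ℝ∣ : ∀ i → ∣ ℤ⇒ℝ i ∣ ≈ ℕ⇒ℝ ℤ.∣ i ∣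
  ∣ℤ⇒ℝ∣ (+ n) with ∣∣-sign (ℕ⇒ℝ n)
  ... | inj₁ (_ , eq) = eq
  ... | inj₂ (≤0 , eq) = ≤-antisym (∣∣-least ≤-refl
        (≤-trans (≤-resp refl -0#≈0# (neg-mono-≤ (0≤ℕ⇒ℝ n))) (0≤ℕ⇒ℝ n))) (x≤∣x∣ _)
  ∣ℤ⇒ℝ∣ -[1+ n ] = trans (∣-x∣ _) (∣ℤ⇒ℝ∣ (+ suc n))

  ∣x∣≤maxNorm : ∀ {n} (x : Vector ℝ n) i → ∣ x i ∣ ≤ maxNorm x
  ∣x∣≤maxNorm {suc n} x zero    = MaxP.x≤x⊔y ∣ x zero ∣ _
  ∣x∣≤maxNorm {suc n} x (suc i) = ≤-trans (∣x∣≤maxNorm (tail x) i) (MaxP.x≤y⊔x ∣ x zero ∣ _)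

  0≤maxNorm : ∀ {n} (x : Vector ℝ n) → 0# ≤ maxNorm x
  0≤maxNorm {zero}  x = ≤-refl
  0≤maxNorm {suc n} x = ≤-trans (0≤∣x∣ _) (∣x∣≤maxNorm x zero)

  maxNorm-least : ∀ {n} (x : Vector ℝ n) {b} → 0# ≤ b → (∀ i → ∣ x i ∣ ≤ b) → maxNorm x ≤ b
  maxNorm-least {zero}  x 0≤b le = 0≤b
  maxNorm-least {suc n} x 0≤b le = MaxP.⊔-lub (le zero) (maxNorm-least (tail x) 0≤b (le ∘ suc))

  -- Positivity excludes the empty vector, whose norm is the default value 0 of the fold.
  maxNorm-attained : ∀ {n} (x : Vector ℝ n) → 0# < maxNorm x → ∃ λ i → maxNorm x ≤ ∣ x i ∣
  maxNorm-attained {zero}  x 0< = ⊥-elim (<⇒≱ 0< ≤-refl)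
  maxNorm-attained {suc n} x 0< = case ≤-total (maxNorm (tail x)) ∣ x zero ∣ of λ where
    (inj₁ p) → zero , MaxP.⊔-lub ≤-refl p
    (inj₂ p) →
      let (i , q) = maxNorm-attained (tail x) (<-≤-trans 0< (MaxP.⊔-lub p ≤-refl))
      in suc i , MaxP.⊔-lub (≤-trans p q) q

  maxNorm-mono : ∀ {m n} (x : Vector ℝ m) (y : Vector ℝ n) →
                 (∀ i → ∃ λ j → ∣ x i ∣ ≤ ∣ y j ∣) → maxNorm x ≤ maxNorm y
  maxNorm-mono x y le = maxNorm-least x (0≤maxNorm y)
    λ i → ≤-trans (proj₂ (le i)) (∣x∣≤maxNorm y (proj₁ (le i)))

  maxNorm-cong : ∀ {n} {x y : Vector ℝ n} → x ≋ y → maxNorm x ≈ maxNorm y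
  maxNorm-cong {x = x} {y} eq = ≤-antisym
    (maxNorm-mono x y λ i → i , ≤-reflexive (∣∣-cong (eq i)))
    (maxNorm-mono y x λ i → i , ≤-reflexive (∣∣-cong (sym (eq i))))

  -- Finite coverings by boxes

  volume-nonNeg : ∀ {d} (B : Box d) → 0# ≤ Box.volume B
  volume-nonNeg {d} B = go (λ i → Box.upper B i + - Box.lower B i) (λ i → 0≤y-x (Box.lower≤upper B i))
    where
    go : ∀ {n} (x : Vector ℝ n) → (∀ i → 0# ≤ x i) → 0# ≤ product x
    go {zero}  x 0≤ = 0≤1
    go {suc n} x 0≤ = *-nonNeg (0≤ zero) (go (tail x) (0≤ ∘ suc))

  totalVolume : ∀ {d} → List (Box d) → ℝ
  totalVolume = List.foldr (λ B s → Box.volume B + s) 0#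

  totalVolume-++ : ∀ {d} (L M : List (Box d)) → totalVolume (L ++ M) ≈ totalVolume L + totalVolume M
  totalVolume-++ []      M = sym (+-identityˡ _)
  totalVolume-++ (B ∷ L) M = trans (+-congˡ (totalVolume-++ L M)) (sym (+-assoc _ _ _))

  -- The relation is a parameter because `grid` has to record more than membership: `slab-cover`
  -- must know that a point lies within `h` of the lower corner in every coordinate.
  CoverBy : ∀ {d} → (Box d → Pred (Vector ℝ d) 0ℓ) → Pred (Vector ℝ d) 0ℓ → ℝ → Set
  CoverBy {d} Q S b = ∃ λ (L : List (Box d)) →
    (∀ x → S x → Any (λ B → Q B x) L) ∧ totalVolume L ≤ b

  Cover : ∀ {d} → Pred (Vector ℝ d) 0ℓ → ℝ → Set
  Cover = CoverBy Box._∋_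

  module _ {d} {Q : Box d → Pred (Vector ℝ d) 0ℓ} where

    cover-mono : ∀ {S S′ b b′} → (∀ x → S′ x → S x) → b ≤ b′ → CoverBy Q S b → CoverBy Q S′ b′
    cover-mono S′⊆S b≤b′ (L , c , le) = L , (λ x → c x ∘ S′⊆S x) , ≤-trans le b≤b′

    cover-∅ : ∀ {S b} → (∀ x → ¬ S x) → 0# ≤ b → CoverBy Q S b
    cover-∅ empty 0≤b = [] , (λ x s → ⊥-elim (empty x s)) , 0≤b

    cover-∪ : ∀ {S S₁ S₂ b₁ b₂} → (∀ x → S x → S₁ x ⊎ S₂ x) →
              CoverBy Q S₁ b₁ → CoverBy Q S₂ b₂ → CoverBy Q S (b₁ + b₂)
    cover-∪ split (L₁ , c₁ , le₁) (L₂ , c₂ , le₂) =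
      L₁ ++ L₂ ,
      (λ x s → case split x s of λ where
        (inj₁ s₁) → Anyₚ.++⁺ˡ (c₁ x s₁)
        (inj₂ s₂) → Anyₚ.++⁺ʳ L₁ (c₂ x s₂)) ,
      ≤-resp (sym (totalVolume-++ L₁ L₂)) refl (+-mono-≤ le₁ le₂)

    cover-⋃ : ∀ m {S : ℕ → Pred (Vector ℝ d) 0ℓ} {b} → (∀ i → CoverBy Q (S i) b) →
              CoverBy Q (λ x → ∃ λ i → i ℕ.< m ∧ S i x) (ℕ⇒ℝ m * b)
    cover-⋃ zero    cov = cover-∅ (λ { x (i , () , _) }) (≤-reflexive (sym (zeroˡ _)))
    cover-⋃ (suc m) {S} {b} cov =
      cover-mono (λ _ s → s) (≤-reflexive (sym (trans (distribʳ b 1# _) (+-congʳ (*-identityˡ b)))))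
        (cover-∪ split (cov 0) (cover-⋃ m {S ∘ suc} (cov ∘ suc)))
      where
      split : ∀ x → (∃ λ i → i ℕ.< suc m ∧ S i x) → S 0 x ⊎ (∃ λ i → i ℕ.< m ∧ S (suc i) x)
      split x (zero  , _ , s)       = inj₁ s
      split x (suc i , s≤s i<m , s) = inj₂ (i , i<m , s)

    cover-⋃-ball : ∀ L {S : ℤ → Pred (Vector ℝ d) 0ℓ} {b} → (∀ i → CoverBy Q (S i) b) →
      CoverBy Q (λ x → ∃ λ i → ℤ.∣ i ∣ ℕ.≤ L ∧ S i x) (ℕ⇒ℝ (suc (L ℕ.+ L)) * b)
    cover-⋃-ball L {S} {b} cov =
      cover-mono (λ _ s → s)
        (≤-reflexive (sym (trans (*-congʳ (ℕ⇒ℝ-+ (suc L) L)) (distribʳ b _ _))))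
        (cover-∪ split (cover-⋃ (suc L) (λ k → cov (+ k))) (cover-⋃ L (λ k → cov -[1+ k ])))
      where
      split : ∀ x → (∃ λ i → ℤ.∣ i ∣ ℕ.≤ L ∧ S i x) →
              (∃ λ k → k ℕ.< suc L ∧ S (+ k) x) ⊎ (∃ λ k → k ℕ.< L ∧ S -[1+ k ] x)
      split x (+ k      , k≤L , s) = inj₁ (k , s≤s k≤L , s)
      split x (-[1+ k ] , k<L , s) = inj₂ (k , k<L , s)

    -- Centre a ball at any index whose set is inhabited: all other such indices lie within `L` of
    -- it, and empty sets cost nothing. No prior knowledge of where the relevant indices are is
    -- required.
    cover-⋃-diameter : ∀ {S : ℤ → Pred (Vector ℝ d) 0ℓ} {b} L →
      (∀ i j → ∃ (S i) → ∃ (S j) → ℤ.∣ i ℤ.- j ∣ ℕ.≤ L) → 0# ≤ b → (∀ i → CoverBy Q (S i) b) →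
      CoverBy Q (λ x → ∃ λ i → S i x) (ℕ⇒ℝ (suc (L ℕ.+ L)) * b)
    cover-⋃-diameter {S} L diam 0≤b cov with em {∃ λ i → ∃ (S i)}
    ... | no empty = cover-∅ (λ { x (i , s) → empty (i , x , s) }) (*-nonNeg (0≤ℕ⇒ℝ (suc (L ℕ.+ L))) 0≤b)
    ... | yes (j , s₀) = cover-mono inc ≤-refl (cover-⋃-ball L {λ k → S (k ℤ.+ j)} (λ k → cov (k ℤ.+ j)))
      where
      inc : ∀ x → (∃ λ i → S i x) → ∃ λ k → ℤ.∣ k ∣ ℕ.≤ L ∧ S (k ℤ.+ j) x
      inc x (i , s) = i ℤ.- j , diam i j (x , s) s₀ , ≡.subst (λ k → S k x) (≡.sym i-j+j≡i) s
        where
        i-j+j≡i : i ℤ.- j ℤ.+ j ≡ i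
        i-j+j≡i = ≡.trans (ℤₚ.+-assoc i (ℤ.- j) j)
          (≡.trans (≡.cong (λ k → i ℤ.+ k) (ℤₚ.+-inverseˡ j)) (ℤₚ.+-identityʳ i))

    -- A vector is a function, so `p` and `p zero ◂ tail p` agree only pointwise; `resp` carries
    -- membership across.
    cover-⋃-cube : ∀ e L {S : Vector ℤ e → Pred (Vector ℝ d) 0ℓ} {b} →
      (∀ {p p′} x → p ≗ p′ → S p x → S p′ x) → (∀ p → CoverBy Q (S p) b) →
      CoverBy Q (λ x → ∃ λ p → (∀ i → ℤ.∣ p i ∣ ℕ.≤ L) ∧ S p x) (ℕ⇒ℝ (suc (L ℕ.+ L) ℕ.^ e) * b)
    cover-⋃-cube zero L {S} {b} resp cov =
      cover-mono (λ { x (p , _ , s) → resp x (λ ()) s })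
        (≤-reflexive (sym (trans (*-congʳ (+-identityʳ 1#)) (*-identityˡ b)))) (cov (λ ()))
    cover-⋃-cube (suc e) L {S} {b} resp cov =
      cover-mono inc
        (≤-reflexive (sym (trans (*-congʳ (ℕ⇒ℝ-* (suc (L ℕ.+ L)) (suc (L ℕ.+ L) ℕ.^ e))) (*-assoc _ _ b))))
        (cover-⋃-ball L λ i → cover-⋃-cube e L {λ p → S (i ◂ p)}
          (λ x eq → resp x λ { zero → ≡.refl ; (suc j) → eq j }) (λ p → cov (i ◂ p)))
      where
      inc : ∀ x → (∃ λ p → (∀ i → ℤ.∣ p i ∣ ℕ.≤ L) ∧ S p x) →
            ∃ λ i → ℤ.∣ i ∣ ℕ.≤ L ∧ ∃ λ p → (∀ j → ℤ.∣ p j ∣ ℕ.≤ L) ∧ S (i ◂ p) x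
      inc x (p , le , s) = p zero , le zero , tail p , le ∘ suc ,
        resp x (λ { zero → ≡.refl ; (suc j) → ≡.refl }) s

  -- Raises the dimension: in its two uses `g` forgets one coordinate and `f` gives each box an edge
  -- of length `c` in that direction.
  cover-map : ∀ {d e} {Q : Box d → Pred (Vector ℝ d) 0ℓ} {Q′ : Box e → Pred (Vector ℝ e) 0ℓ}
    {S S′ b} c (f : Box d → Box e) (g : Vector ℝ e → Vector ℝ d) → 0# ≤ c →
    (∀ B → Box.volume (f B) ≤ c * Box.volume B) →
    (∀ x → S′ x → S (g x)) → (∀ B x → S′ x → Q B (g x) → Q′ (f B) x) →
    CoverBy Q S b → CoverBy Q′ S′ (c * b)
  cover-map {Q = Q} {Q′} {S} {S′} c f g 0≤c vol S′⊆S Q⇒Q′ (L , cov , le) =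
    List.map f L ,
    (λ x s → Anyₚ.map⁺ (Any.map (Q⇒Q′ _ x s) (cov (g x) (S′⊆S x s)))) ,
    ≤-trans (go L) (*-monoʳ-≤ c 0≤c le)
    where
    go : ∀ L → totalVolume (List.map f L) ≤ c * totalVolume L
    go []      = ≤-reflexive (sym (zeroʳ c))
    go (B ∷ L) = ≤-resp refl (sym (distribˡ c _ _)) (+-mono-≤ (vol B) (go L))

  -- A floor function by induction. It cuts an edge into cells and, with step 1, rounds a real to a
  -- natural number.
  locate : ∀ h n y → 0# ≤ y → y ≤ ℕ⇒ℝ (suc n) * h →
           ∃ λ i → i ℕ.< suc n ∧ ℕ⇒ℝ i * h ≤ y ∧ y ≤ ℕ⇒ℝ i * h + h
  locate h zero    y 0≤y y≤ = 0 , s≤s z≤n , ≤-resp (sym (zeroˡ h)) refl 0≤y ,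
    ≤-resp refl (solve 1 (λ h → (:1 :+ :0) :* h := :0 :* h :+ h) refl h) y≤
  locate h (suc n) y 0≤y y≤ with ≤-total y (ℕ⇒ℝ (suc n) * h)
  ... | inj₁ p = let (i , i<n , q) = locate h n y 0≤y p in i , ℕₚ.m<n⇒m<1+n i<n , q
  ... | inj₂ p = suc n , ℕₚ.≤-refl , p ,
    ≤-resp refl (solve 2 (λ h k → (:1 :+ k) :* h := k :* h :+ h) refl h (ℕ⇒ℝ (suc n))) y≤

  InCube : ∀ {d} → ℕ → Pred (Vector ℝ d) 0ℓ
  InCube T x = ∀ j → ∣ x j ∣ ≤ ℕ⇒ℝ T

  Fine : ∀ {d} → ℝ → Box d → Pred (Vector ℝ d) 0ℓ
  Fine h B x = Box._∋_ B x ∧ (∀ j → x j ≤ Box.lower B j + h)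

  cons-box : ∀ {d} (a b : ℝ) → a ≤ b → Box d → Box (suc d)
  cons-box a b a≤b B = record
    { lower       = a ◂ Box.lower B
    ; upper       = b ◂ Box.upper B
    ; lower≤upper = λ { zero → a≤b ; (suc i) → Box.lower≤upper B i }
    }

  -- The bound is the volume of the cube itself and does not involve the mesh, so `slab-cover` may
  -- refine the grid freely.
  grid : ∀ d T m h → ℕ⇒ℝ (suc m) * h ≈ 1# → 0# ≤ h →
         CoverBy (Fine h) (InCube {d} (suc T)) (ℕ⇒ℝ ((2 ℕ.* suc T) ℕ.^ d))
  grid zero T m h mh≈1 0≤h =
    unit ∷ [] , (λ x _ → here ((λ ()) , λ ())) , ≤-refl
    where
    unit : Box 0
    unit = record { lower = λ () ; upper = λ () ; lower≤upper = λ () }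
  grid (suc d) T m h mh≈1 0≤h = cover-mono inc cost (cover-⋃ cells slice)
    where
    -- This is `2 * suc T * suc m`, unfolded to expose the successor that `locate` expects: the edge
    -- has length `2 * suc T`, with `suc m` cells per unit.
    cells = suc (m ℕ.+ (T ℕ.+ suc (T ℕ.+ 0)) ℕ.* suc m)
    t = ℕ⇒ℝ (suc T)

    low : ℕ → ℝ
    low i = - t + ℕ⇒ℝ i * h

    low≤ : ∀ i → low i ≤ low i + h
    low≤ i = x≤x+y 0≤h

    Slice : ℕ → Pred (Vector ℝ (suc d)) 0ℓ
    Slice i x = (low i ≤ x zero ∧ x zero ≤ low i + h) ∧ InCube (suc T) (tail x)

    cells*h : ℕ⇒ℝ cells * h ≈ ℕ⇒ℝ (2 ℕ.* suc T)
    cells*h = begin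
      ℕ⇒ℝ (2 ℕ.* suc T ℕ.* suc m) * h         ≈⟨ *-congʳ (ℕ⇒ℝ-* (2 ℕ.* suc T) (suc m)) ⟩
      ℕ⇒ℝ (2 ℕ.* suc T) * ℕ⇒ℝ (suc m) * h     ≈⟨ *-assoc _ _ h ⟩
      ℕ⇒ℝ (2 ℕ.* suc T) * (ℕ⇒ℝ (suc m) * h)   ≈⟨ *-congˡ mh≈1 ⟩
      ℕ⇒ℝ (2 ℕ.* suc T) * 1#                  ≈⟨ *-identityʳ _ ⟩
      ℕ⇒ℝ (2 ℕ.* suc T)                       ∎
      where open SetoidReasoning setoid

    cost : ℕ⇒ℝ cells * (h * ℕ⇒ℝ ((2 ℕ.* suc T) ℕ.^ d)) ≤ ℕ⇒ℝ ((2 ℕ.* suc T) ℕ.^ suc d)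
    cost = ≤-reflexive (trans (sym (*-assoc _ h _)) (trans (*-congʳ cells*h) (sym (ℕ⇒ℝ-* (2 ℕ.* suc T) ((2 ℕ.* suc T) ℕ.^ d)))))

    slice : ∀ i → CoverBy (Fine h) (Slice i) (h * ℕ⇒ℝ ((2 ℕ.* suc T) ℕ.^ d))
    slice i = cover-map h (cons-box (low i) (low i + h) (low≤ i)) tail 0≤h
      (λ B → ≤-reflexive (*-congʳ (solve 2 (λ a h → (a :+ h) :+ :- a := h) refl (low i) h)))
      (λ x → proj₂)
      (λ { B x ((p , q) , _) (B∋x , fine) →
           (λ { zero → p , q ; (suc j) → B∋x j }) , (λ { zero → q ; (suc j) → fine j }) })
      (grid d T m h mh≈1 0≤h)

    inc : ∀ x → InCube (suc T) x → ∃ λ i → i ℕ.< cells ∧ Slice i x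
    inc x x∈ =
      let (i , i< , p , q) = locate h _ (x zero + t)
            (lin (-x≤∣x∣ (x zero)) (solve 2 (λ x a → :0 :+ a := x :+ a :+ :- x) refl (x zero) ∣ x zero ∣)
             ⟨≤⟩ +-monoʳ-≤ (x zero) (x∈ zero))
            (≤-resp refl (sym cells*h)
              (lin (≤-trans (x≤∣x∣ _) (x∈ zero))
                (trans (solve 2 (λ x t → x :+ t :+ t := (:2 :* t) :+ x) refl (x zero) t)
                       (+-congʳ (sym (ℕ⇒ℝ-* 2 (suc T)))))))
      in i , i< ,
         ( lin p (solve 3 (λ t y x → (:- t :+ y) :+ (x :+ t) := x :+ y) refl t (ℕ⇒ℝ i * h) (x zero))
         , lin q (solve 4 (λ t y x h → x :+ (y :+ h) := ((:- t :+ y) :+ h) :+ (x :+ t)) refl t (ℕ⇒ℝ i * h) (x zero) h)) ,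
         x∈ ∘ suc
      where
      infixr 3 _⟨≤⟩_
      _⟨≤⟩_ : ∀ {x y z} → x ≤ y → y ≤ z → x ≤ z
      _⟨≤⟩_ = ≤-trans

  -- Dot products and the volume of a slab

  sumAbs : ∀ {n} → Vector ℝ n → ℝ
  sumAbs v = sum (Vector.map ∣_∣ v)

  sumAbs≤ : ∀ {n} (v : Vector ℝ n) → sumAbs v ≤ ℕ⇒ℝ n * maxNorm v
  sumAbs≤ {n} v = go v (maxNorm v) (∣x∣≤maxNorm v)
    where
    go : ∀ {n} (v : Vector ℝ n) b → (∀ i → ∣ v i ∣ ≤ b) → sumAbs v ≤ ℕ⇒ℝ n * b
    go {zero}  v b le = ≤-reflexive (sym (zeroˡ b))
    go {suc n} v b le = ≤-resp refl (sym (trans (distribʳ b _ _) (+-congʳ (*-identityˡ b))))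
      (+-mono-≤ (le zero) (go (tail v) b (le ∘ suc)))

  ∣dot∣≤ : ∀ {n} (x v : Vector ℝ n) {h} → (∀ j → ∣ x j ∣ ≤ h) → ∣ x · v ∣ ≤ h * sumAbs v
  ∣dot∣≤ {zero}  x v {h} le = ≤-reflexive (trans (∣∣-cong (sym -0#≈0#)) (trans (∣-x∣ 0#)
    (trans (≤-antisym (∣∣-least ≤-refl (≤-reflexive -0#≈0#)) (0≤∣x∣ 0#)) (sym (zeroʳ h)))))
  ∣dot∣≤ {suc n} x v {h} le = ≤-trans (∣x+y∣≤ _ _)
    (≤-resp refl (sym (distribˡ h _ _))
      (+-mono-≤ (≤-trans (≤-reflexive (∣x*y∣ (x zero) (v zero))) (*-monoˡ-≤ _ (0≤∣x∣ _) (le zero)))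
                (∣dot∣≤ (tail x) (tail v) (le ∘ suc))))

  dot-sub : ∀ {n} (x y v : Vector ℝ n) → (λ j → x j + - y j) · v ≈ x · v + - (y · v)
  dot-sub {zero}  x y v = sym (-‿inverseʳ 0#)
  dot-sub {suc n} x y v = trans (+-congˡ (dot-sub (tail x) (tail y) (tail v)))
    (solve 5 (λ x y v a b → (x :+ :- y) :* v :+ (a :+ :- b) := (x :* v :+ a) :+ :- (y :* v :+ b))
      refl (x zero) (y zero) (v zero) (tail x · tail v) (tail y · tail v))

  dot-cong : ∀ {n} {x x′ v v′ : Vector ℝ n} → x ≋ x′ → v ≋ v′ → x · v ≈ x′ · v′
  dot-cong eq eq′ = sum-cong-≋ (λ j → *-cong (eq j) (eq′ j))

  insert-box : ∀ {d} (i : Fin (suc d)) (a b : ℝ) → a ≤ b → Box d → Box (suc d)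
  insert-box i a b a≤b B = record
    { lower       = insertAt (Box.lower B) i a
    ; upper       = insertAt (Box.upper B) i b
    ; lower≤upper = le i (Box.lower B) (Box.upper B) (Box.lower≤upper B)
    }
    where
    le : ∀ {d} (i : Fin (suc d)) (l u : Vector ℝ d) → (∀ j → l j ≤ u j) →
         ∀ j → insertAt l i a j ≤ insertAt u i b j
    le zero            l u l≤u zero    = a≤b
    le zero            l u l≤u (suc j) = l≤u j
    le {suc d} (suc i) l u l≤u zero    = l≤u zero
    le {suc d} (suc i) l u l≤u (suc j) = le i (tail l) (tail u) (l≤u ∘ suc) j

  insert-box-∋ : ∀ {d} (i : Fin (suc d)) {a b} (a≤b : a ≤ b) (B : Box d) x →
    a ≤ x i → x i ≤ b → Box._∋_ B (removeAt x i) → Box._∋_ (insert-box i a b a≤b B) x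
  insert-box-∋ i {a} {b} _ B x a≤ ≤b B∋ = go i (Box.lower B) (Box.upper B) x a≤ ≤b B∋
    where
    go : ∀ {d} (i : Fin (suc d)) (l u : Vector ℝ d) x → a ≤ x i → x i ≤ b →
         (∀ j → l j ≤ x (punchIn i j) ∧ x (punchIn i j) ≤ u j) →
         ∀ j → insertAt l i a j ≤ x j ∧ x j ≤ insertAt u i b j
    go zero            l u x p q r zero    = p , q
    go zero            l u x p q r (suc j) = r j
    go {suc d} (suc i) l u x p q r zero    = r zero
    go {suc d} (suc i) l u x p q r (suc j) = go i (tail l) (tail u) (tail x) p q (r ∘ suc) j

  insert-box-volume : ∀ {d} (i : Fin (suc d)) {a b} (a≤b : a ≤ b) (B : Box d) →
    Box.volume (insert-box i a b a≤b B) ≈ (b + - a) * Box.volume B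
  insert-box-volume i {a} {b} _ B = go i (Box.lower B) (Box.upper B)
    where
    go : ∀ {d} (i : Fin (suc d)) (l u : Vector ℝ d) →
         product (λ j → insertAt u i b j + - insertAt l i a j) ≈ (b + - a) * product (λ j → u j + - l j)
    go zero            l u = refl
    go {suc d} (suc i) l u = trans (*-congˡ (go i (tail l) (tail u)))
      (solve 3 (λ x y z → x :* (y :* z) := y :* (x :* z)) refl _ _ _)

  -- Cells of side at most h, in the coordinates other than i, are so small
  -- that a + x · v varies by at most w over each of them; the slab then meets
  -- a cell in an i-interval of length 4 w ∣ u ∣.
  slab-cover : ∀ {e} T a (v : Vector ℝ (suc e)) i u w → v i * u ≈ 1# → 0# < w →
    Cover (λ x → InCube (suc T) x ∧ ∣ a + x · v ∣ ≤ w)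
          (ℕ⇒ℝ 4 * (w * ∣ u ∣) * ℕ⇒ℝ ((2 ℕ.* suc T) ℕ.^ e))
  slab-cover {e} T a v i u w viu≈1 0<w = cover-map (ℕ⇒ℝ 4 * (w * ∣ u ∣)) box (λ x → removeAt x i)
    (*-nonNeg (0≤ℕ⇒ℝ 4) 0≤w∣u∣) volume≤ (λ x s j → proj₁ s (punchIn i j)) inside
    (grid e T m h (proj₂ (proj₂ h-inverse)) (proj₁ (proj₂ h-inverse)))
    where
    v′ = removeAt v i
    Λ = sumAbs v′
    w⁻¹ = positive-inverse 0<w
    -- `m` is at least `Λ / w` and `h` is `1 / (m + 1)`, hence `h * Λ ≤ w`.
    m = proj₁ (archimedean (Λ * proj₁ w⁻¹))
    h-inverse = positive-inverse {ℕ⇒ℝ (suc m)} (0<ℕ⇒ℝ (suc m))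
    h = proj₁ h-inverse

    0≤h : 0# ≤ h
    0≤h = proj₁ (proj₂ h-inverse)

    0≤w∣u∣ : 0# ≤ w * ∣ u ∣
    0≤w∣u∣ = *-nonNeg (proj₁ 0<w) (0≤∣x∣ u)

    Λ≤mw : Λ ≤ ℕ⇒ℝ (suc m) * w
    Λ≤mw = ≤-resp
      (trans (solve 3 (λ l y w → l :* y :* w := l :* (w :* y)) refl Λ (proj₁ w⁻¹) w)
        (trans (*-congˡ (proj₂ (proj₂ w⁻¹))) (*-identityʳ Λ)))
      refl
      (*-monoˡ-≤ w (proj₁ 0<w) (≤-trans (proj₂ (archimedean (Λ * proj₁ w⁻¹))) (ℕ⇒ℝ-mono (ℕₚ.n≤1+n m))))

    hΛ≤w : h * Λ ≤ w
    hΛ≤w = ≤-resp refl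
      (trans (solve 3 (λ h m w → h :* (m :* w) := (m :* h) :* w) refl h (ℕ⇒ℝ (suc m)) w)
        (trans (*-congʳ (proj₂ (proj₂ h-inverse))) (*-identityˡ w)))
      (*-monoʳ-≤ h 0≤h Λ≤mw)

    -- The centre `c B` is the zero of the form in coordinate `i` when the other coordinates sit at
    -- the lower corner of `B`. The radius allows one `w` for the slab and one for the variation
    -- over the cell.
    r : ℝ
    r = 2# * (w * ∣ u ∣)

    0≤r : 0# ≤ r
    0≤r = *-nonNeg (0≤ℕ⇒ℝ 2) 0≤w∣u∣

    c : Box e → ℝ
    c B = - ((a + Box.lower B · v′) * u)

    c-r≤c+r : ∀ B → c B + - r ≤ c B + r
    c-r≤c+r B = lin (+-mono-≤ 0≤r 0≤r)
      (solve 2 (λ c r → (c :+ :- r) :+ (r :+ r) := (c :+ r) :+ (:0 :+ :0)) refl (c B) r)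

    box : Box e → Box (suc e)
    box B = insert-box i (c B + - r) (c B + r) (c-r≤c+r B) B

    volume≤ : ∀ B → Box.volume (box B) ≤ ℕ⇒ℝ 4 * (w * ∣ u ∣) * Box.volume B
    volume≤ B = ≤-reflexive (trans (insert-box-volume i (c-r≤c+r B) B) (*-congʳ
      (solve 2 (λ c z → (c :+ :2 :* z) :+ :- (c :+ :- (:2 :* z)) := con (+ 4) :* z) refl (c B) (w * ∣ u ∣))))

    inside : ∀ B x → InCube (suc T) x ∧ ∣ a + x · v ∣ ≤ w → Fine h B (removeAt x i) →
             Box._∋_ (box B) x
    inside B x (_ , ≤w) (B∋ , fine) = insert-box-∋ i (c-r≤c+r B) B x
      (lin near⁻ (solve 3 (λ y x r → (:- y :+ :- r) :+ r := x :+ :- (y :+ x)) refl y (x i) r))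
      (lin near⁺ (solve 3 (λ y x r → x :+ r := (:- y :+ r) :+ (y :+ x)) refl y (x i) r))
      B∋
      where
      l = Box.lower B
      x′ = removeAt x i
      y = (a + l · v′) * u

      x·v : x · v ≈ x i * v i + x′ · v′
      x·v = sum-remove {i = i} (Vector.zipWith _*_ x v)

      deviation : ∣ l · v′ + - (x′ · v′) ∣ ≤ w
      deviation = ≤-trans (≤-reflexive (∣∣-cong (sym (dot-sub l x′ v′))))
        (≤-trans (∣dot∣≤ _ v′ λ j → ∣∣-least
          (lin (+-mono-≤ (proj₁ (B∋ j)) 0≤h)
            (solve 3 (λ l x h → (l :+ :- x) :+ (x :+ h) := h :+ (l :+ :0)) refl (l j) (x′ j) h))
          (lin (fine j)
            (solve 3 (λ l x h → :- (l :+ :- x) :+ (l :+ h) := h :+ x) refl (l j) (x′ j) h)))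
        hΛ≤w)

      near : ∣ y + x i ∣ ≤ r
      near = ≤-trans (≤-reflexive (trans (∣∣-cong eq) (∣x*y∣ _ u)))
        (≤-resp refl (solve 2 (λ w u → (w :+ w) :* u := :2 :* (w :* u)) refl w ∣ u ∣)
          (*-monoˡ-≤ ∣ u ∣ (0≤∣x∣ u) (≤-trans (∣x+y∣≤ _ _) (+-mono-≤ ≤w deviation))))
        where
        open SetoidReasoning setoid
        eq : y + x i ≈ ((a + x · v) + (l · v′ + - (x′ · v′))) * u
        eq = begin
          y + x i                                                  ≈⟨ +-congˡ (sym (*-identityʳ (x i))) ⟩
          y + x i * 1#                                             ≈⟨ +-congˡ (*-congˡ (sym viu≈1)) ⟩
          y + x i * (v i * u)                                      ≈⟨ solve 6 (λ a p q x v u → (a :+ p) :* u :+ x :* (v :* u)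
                                                                        := ((a :+ (x :* v :+ q)) :+ (p :+ :- q)) :* u)
                                                                        refl a (l · v′) (x′ · v′) (x i) (v i) u ⟩
          ((a + (x i * v i + x′ · v′)) + (l · v′ + - (x′ · v′))) * u   ≈⟨ *-congʳ (+-congʳ (+-congˡ (sym x·v))) ⟩
          ((a + x · v) + (l · v′ + - (x′ · v′))) * u               ∎

      near⁺ : y + x i ≤ r
      near⁺ = ≤-trans (x≤∣x∣ _) near

      near⁻ : - (y + x i) ≤ r
      near⁻ = ≤-trans (-x≤∣x∣ _) near

  -- Diophantine approximation

  ^-distribʳ-* : ∀ n a b → (a ℕ.* b) ℕ.^ n ≡ a ℕ.^ n ℕ.* b ℕ.^ n
  ^-distribʳ-* zero    a b = ≡.refl
  ^-distribʳ-* (suc n) a b = ≡.trans (≡.cong (a ℕ.* b ℕ.*_) (^-distribʳ-* n a b)) (eq a b (a ℕ.^ n) (b ℕ.^ n))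
    where
    eq : ∀ a b x y → a ℕ.* b ℕ.* (x ℕ.* y) ≡ a ℕ.* x ℕ.* (b ℕ.* y)
    eq = ℕ-solve-∀

  point : ∀ {n} → Vector ℝ n → ℤ → Vector ℤ n → Vector ℝ n
  point α q p i = ℤ⇒ℝ (p i) + α i * ℤ⇒ℝ q

  maxNorm-scale : ∀ {n} (x : Vector ℝ n) k → 0# ≤ k → maxNorm (λ i → k * x i) ≤ k * maxNorm x
  maxNorm-scale x k 0≤k = maxNorm-least _ (*-nonNeg 0≤k (0≤maxNorm x)) λ i →
    ≤-resp (sym (trans (∣∣-cong (*-comm k (x i))) (∣x*y∣-nonNeg (x i) 0≤k))) (*-comm _ k)
      (*-monoˡ-≤ k 0≤k (∣x∣≤maxNorm x i))

  BadlyApproximable : ∀ {n} → Vector ℝ n → ℕ → Set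
  BadlyApproximable {n} α C =
    ∀ q p → q ≢ ℤ.0ℤ → 1# ≤ ℕ⇒ℝ (C ℕ.* ℤ.∣ q ∣ ℕ.^ n) * maxNorm (point α q p)

  -- `t ^- u` is a supremum over rational exponents that are at least `u`, and the integer `n` is
  -- one of them; so `t ^ (- n)` does not exceed it.
  1≤t^n*norm : ∀ n (t : ℕ) .{{_ : ℕ.NonZero t}} u y → u < ℕ⇒ℝ n → t ^- u ≤ y → 1# ≤ ℕ⇒ℝ (t ℕ.^ n) * y
  1≤t^n*norm n t u y (u≤n , _) t^-u≤y =
    ≤-resp (proj₂ (proj₂ inv)) refl
      (*-monoʳ-≤ _ (0≤ℕ⇒ℝ (t ℕ.^ n)) (≤-trans (proj₁ (^-‿isSupremum t u) z below) t^-u≤y))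
    where
    inv : ∃ λ y → 0# ≤ y ∧ ℕ⇒ℝ (t ℕ.^ n) * y ≈ 1#
    inv = positive-inverse (0<ℕ⇒ℝ (t ℕ.^ n) {{ℕₚ.m^n≢0 t n}})
    z = proj₁ inv
    below : BelowPower t u z
    below = proj₁ (proj₂ inv) , n , 1 , _ ,
      ≤-resp (sym (trans (*-congʳ (+-identityʳ 1#)) (*-identityˡ u))) refl u≤n ,
      ≤-reflexive (trans (*-cong (*-identityʳ z) (sym (ℕ⇒ℝ-^ t n)))
        (trans (*-comm z _) (proj₂ (proj₂ inv))))

  list-bound : ∀ {X : Set} (f : X → ℕ) (xs : List X) → ∃ λ B → ∀ x → x ∈ xs → f x ℕ.≤ B
  list-bound f []       = 0 , λ x ()
  list-bound f (y ∷ xs) = let (B , le) = list-bound f xs in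
    f y ℕ.⊔ B , λ { x (here ≡.refl) → ℕₚ.m≤m⊔n (f y) B
                  ; x (there x∈xs)  → ℕₚ.≤-trans (le x x∈xs) (ℕₚ.m≤n⊔m (f y) B) }

  point-scale : ∀ {n} (α : Vector ℝ n) k q p →
    point α (k ℤ.* q) (λ i → k ℤ.* p i) ≋ (λ i → ℤ⇒ℝ k * point α q p i)
  point-scale α k q p i = trans (+-cong (ℤ⇒ℝ-* k (p i)) (*-congˡ (ℤ⇒ℝ-* k q)))
    (solve 4 (λ k p α q → k :* p :+ α :* (k :* q) := k :* (p :+ α :* q)) refl
      (ℤ⇒ℝ k) (ℤ⇒ℝ (p i)) (α i) (ℤ⇒ℝ q))

  -- Outside a finite set of q the bound holds with C = 1; replacing q by a
  -- multiple Q q that lies outside this set costs a factor Q ^ suc n.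
  ¬𝒲⁻⇒BadlyApproximable : ∀ {n} (α : Vector ℝ n) → ¬ 𝒲⁻ n (ℕ⇒ℝ n) α →
    ∃ λ C → 1 ℕ.≤ C ∧ BadlyApproximable α C
  ¬𝒲⁻⇒BadlyApproximable {n} α ¬𝒲⁻α with em {∃ λ u → 0# < u ∧ u < ℕ⇒ℝ n ∧ ¬ 𝒲 n u α}
  ... | no ¬∃ = ⊥-elim (¬𝒲⁻α λ u 0<u u<n fin → ¬∃ (u , 0<u , u<n , λ inf → inf fin))
  -- `𝒲` denies that some list contains all solutions, so its failure is a double negation; excluded
  -- middle turns it into an actual list of exceptional `q`.
  ... | yes (u , 0<u , u<n , ¬𝒲u) with em {∃ λ (xs : List ℤ) → ∀ q → _ → q ∈ xs}
  ...   | no ¬fin = ⊥-elim (¬𝒲u ¬fin)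
  ...   | yes (xs , exceptions) = Q ℕ.^ suc n , ℕₚ.m^n>0 Q (suc n) , bound
    where
    Q = suc (proj₁ (list-bound ℤ.∣_∣ xs))

    large : ∀ q p → q ≢ ℤ.0ℤ → Q ℕ.≤ ℤ.∣ q ∣ → 1# ≤ ℕ⇒ℝ (ℤ.∣ q ∣ ℕ.^ n) * maxNorm (point α q p)
    large q p q≢0 Q≤∣q∣ = 1≤t^n*norm n ℤ.∣ q ∣ {{nz}} u _ u<n
      (≮⇒≥ λ lt → ℕₚ.<⇒≱ Q≤∣q∣ (proj₂ (list-bound ℤ.∣_∣ xs) q (exceptions q (q≢0 , p , lt))))
      where
      nz : ℕ.NonZero ℤ.∣ q ∣
      nz = ≢-nonZero λ eq → q≢0 (ℤₚ.∣i∣≡0⇒i≡0 eq)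

    bound : BadlyApproximable α (Q ℕ.^ suc n)
    bound q p q≢0 = ≤-trans
      (large (+ Q ℤ.* q) (λ i → + Q ℤ.* p i) Qq≢0
        (≡.subst (Q ℕ.≤_) (≡.sym ∣Qq∣) (ℕₚ.m≤m*n Q ℤ.∣ q ∣ {{≢-nonZero (q≢0 ∘ ℤₚ.∣i∣≡0⇒i≡0)}})))
      (≤-resp refl (sym eq) (*-monoʳ-≤ _ (0≤ℕ⇒ℝ (ℤ.∣ + Q ℤ.* q ∣ ℕ.^ n))
        (≤-trans (≤-reflexive (maxNorm-cong (point-scale α (+ Q) q p))) (maxNorm-scale (point α q p) (ℕ⇒ℝ Q) (0≤ℕ⇒ℝ Q)))))
      where
      ∣Qq∣ : ℤ.∣ + Q ℤ.* q ∣ ≡ Q ℕ.* ℤ.∣ q ∣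
      ∣Qq∣ = ℤₚ.abs-* (+ Q) q
      Qq≢0 : + Q ℤ.* q ≢ ℤ.0ℤ
      Qq≢0 eq with ℤₚ.i*j≡0⇒i≡0∨j≡0 (+ Q) eq
      ... | inj₂ q≡0 = q≢0 q≡0
      eq : ℕ⇒ℝ (Q ℕ.^ suc n ℕ.* ℤ.∣ q ∣ ℕ.^ n) * maxNorm (point α q p)
           ≈ ℕ⇒ℝ (ℤ.∣ + Q ℤ.* q ∣ ℕ.^ n) * (ℕ⇒ℝ Q * maxNorm (point α q p))
      eq = trans (*-congʳ (trans (ℕ⇒ℝ-cong nat) (ℕ⇒ℝ-* (ℤ.∣ + Q ℤ.* q ∣ ℕ.^ n) Q))) (*-assoc _ _ _)
        where
        nat : Q ℕ.^ suc n ℕ.* ℤ.∣ q ∣ ℕ.^ n ≡ ℤ.∣ + Q ℤ.* q ∣ ℕ.^ n ℕ.* Q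
        nat = ≡.trans (≡.cong (ℕ._* ℤ.∣ q ∣ ℕ.^ n) (ℕₚ.*-comm Q (Q ℕ.^ n)))
          (≡.trans (ℕₚ.*-assoc (Q ℕ.^ n) Q _)
          (≡.trans (≡.cong (Q ℕ.^ n ℕ.*_) (ℕₚ.*-comm Q _))
          (≡.trans (≡.sym (ℕₚ.*-assoc (Q ℕ.^ n) _ Q))
            (≡.cong (ℕ._* Q) (≡.trans (≡.sym (^-distribʳ-* n Q ℤ.∣ q ∣)) (≡.cong (ℕ._^ n) (≡.sym ∣Qq∣)))))))

  -- Slabs

  Slab : ∀ {d} → ℕ → ℝ → Vector ℝ (suc d) → Pred (Vector ℝ d) 0ℓ
  Slab T w v x = InCube (suc T) x ∧ ∣ (1# ◂ x) · v ∣ ≤ w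

  -- The condition 2 w ≤ ‖v‖ ensures that the constant term v₀ is not much
  -- larger than the other coefficients if the slab meets the cube.
  Near : ∀ {d} → ℕ → ℝ → ℕ → Vector ℝ (suc d) → Pred (Vector ℝ d) 0ℓ
  Near T w D v x = 2# * w ≤ maxNorm v ∧ 1# ≤ ℕ⇒ℝ D * maxNorm v ∧ Slab T w v x

  Near-resp : ∀ {d} T w D {v v′ : Vector ℝ (suc d)} x → v ≋ v′ → Near T w D v x → Near T w D v′ x
  Near-resp T w D x eq (2w≤ , 1≤ , x∈ , ≤w) =
    ≤-resp refl (maxNorm-cong eq) 2w≤ ,
    ≤-resp refl (*-congˡ (maxNorm-cong eq)) 1≤ ,
    x∈ ,
    ≤-resp (∣∣-cong (dot-cong {x = 1# ◂ x} (λ _ → refl) eq)) refl ≤w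

  dominance : ℕ → ℕ → ℕ
  dominance d T = 2 ℕ.* suc (suc T ℕ.* d)

  -- On the slab the constant term cancels `x · tail v` up to `w`, so it is at most
  -- `w + suc T * d * V` with `V` the norm of the tail. Thus `‖v‖ ≤ w + (1 + suc T * d) * V`, and
  -- `2 w ≤ ‖v‖` absorbs `w` at the price of the factor 2 in `dominance`.
  norm≤tail-norm : ∀ {d} T w (v : Vector ℝ (suc d)) x → Slab T w v x → 2# * w ≤ maxNorm v →
    maxNorm v ≤ ℕ⇒ℝ (dominance d T) * maxNorm (tail v)
  norm≤tail-norm {d} T w v x (x∈ , ≤w) 2w≤ =
    lin (+-mono-≤ (+-mono-≤ norm≤ norm≤) 2w≤)
      (trans (solve 4 (λ m w y V → m :+ (((w :+ (:1 :+ y) :* V) :+ (w :+ (:1 :+ y) :* V)) :+ m)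
                 := (:2 :* (:1 :+ y)) :* V :+ ((m :+ m) :+ :2 :* w)) refl (maxNorm v) w y V)
             (+-congʳ (*-congʳ (sym (ℕ⇒ℝ-* 2 (suc (suc T ℕ.* d)))))))
    where
    V = maxNorm (tail v)
    y = ℕ⇒ℝ (suc T ℕ.* d)

    ∣x·v∣≤ : ∣ x · tail v ∣ ≤ y * V
    ∣x·v∣≤ = ≤-trans (∣dot∣≤ x (tail v) x∈)
      (≤-resp refl (trans (sym (*-assoc _ _ _)) (*-congʳ (sym (ℕ⇒ℝ-* (suc T) d))))
        (*-monoʳ-≤ _ (0≤ℕ⇒ℝ (suc T)) (sumAbs≤ (tail v))))

    v₀≤ : ∣ v zero ∣ ≤ w + y * V
    v₀≤ = ≤-trans (≤-reflexive (∣∣-cong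
        (solve 2 (λ v a → v := (:1 :* v :+ a) :+ :- a) refl (v zero) (x · tail v))))
      (≤-trans (∣x+y∣≤ _ _) (+-mono-≤ ≤w (≤-trans (≤-reflexive (∣-x∣ _)) ∣x·v∣≤)))

    0≤V : 0# ≤ V
    0≤V = 0≤maxNorm (tail v)

    0≤w : 0# ≤ w
    0≤w = ≤-trans (0≤∣x∣ _) ≤w

    0≤y : 0# ≤ y
    0≤y = 0≤ℕ⇒ℝ (suc T ℕ.* d)

    norm≤ : maxNorm v ≤ w + (1# + y) * V
    norm≤ = maxNorm-least v (0≤x+y 0≤w (*-nonNeg (0≤x+y 0≤1 0≤y) 0≤V)) λ where
      zero    → ≤-trans v₀≤ (lin 0≤V (solve 3 (λ w y V → (w :+ y :* V) :+ V := (w :+ (:1 :+ y) :* V) :+ :0) refl w y V))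
      (suc i) → ≤-trans (∣x∣≤maxNorm (tail v) i) (lin (0≤x+y 0≤w (*-nonNeg 0≤y 0≤V))
        (solve 3 (λ w y V → V :+ (w :+ y :* V) := (w :+ (:1 :+ y) :* V) :+ :0) refl w y V))

  -- The 36 is 9 times 4: at most `9 * Y` constant terms are counted in `line-cover`, and each slab
  -- costs `4 w ∣ u ∣` times the volume of the cube in the remaining coordinates.
  line-constant : ℕ → ℕ → ℕ
  line-constant e T = 36 ℕ.* dominance (suc e) T ℕ.* (2 ℕ.* suc T) ℕ.^ e

  -- The slabs that differ only in the constant term of their equation: if V
  -- is the largest coefficient, about V of them meet the cube, and each has
  -- volume of order w / V.
  line-cover : ∀ {e} T w D (β : ℝ) (v′ : Vector ℝ (suc e)) → 0# < w → 1 ℕ.≤ D →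
    Cover (λ x → ∃ λ i → Near T w D ((ℤ⇒ℝ i + β) ◂ v′) x) (ℕ⇒ℝ (line-constant e T ℕ.* D) * w)
  line-cover {e} T w D β v′ 0<w 1≤D with em {∃ λ x → ∃ λ i → Near T w D ((ℤ⇒ℝ i + β) ◂ v′) x}
  ... | no empty = cover-∅ (λ x s → empty (x , s)) (*-nonNeg (0≤ℕ⇒ℝ (line-constant e T ℕ.* D)) (proj₁ 0<w))
  -- The tail `v′` is common to all `i`, so one member of the union already bounds its norm `V` from
  -- below.
  ... | yes (x₀ , i₀ , 2w≤₀ , 1≤₀ , slab₀) =
    cover-mono (λ _ s → s) cost
      (cover-⋃-diameter (m ℕ.+ m) diameter (*-nonNeg (*-nonNeg (0≤ℕ⇒ℝ 4) (*-nonNeg (proj₁ 0<w) (0≤∣x∣ u))) (0≤ℕ⇒ℝ P))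
        λ i → cover-mono (λ { x (_ , _ , x∈ , ≤w) → x∈ , ≤-resp (∣∣-cong (+-congʳ (*-identityˡ _))) refl ≤w }) ≤-refl
          (slab-cover T (ℤ⇒ℝ i + β) v′ k u w v′u≈1 0<w))
    where
    τ = dominance (suc e) T
    P = (2 ℕ.* suc T) ℕ.^ e
    V = maxNorm v′
    -- The factor `D` keeps `Y` at least 1 even when `V` is small. Rounding up then costs only a
    -- constant factor: `4 * m + 1`, which is `4 * j + 5`, is at most `9 * Y`.
    Y = ℕ⇒ℝ (D ℕ.* τ) * V

    norm : ℤ → ℝ
    norm i = maxNorm ((ℤ⇒ℝ i + β) ◂ v′)

    norm≤τV : ∀ i x → Near T w D ((ℤ⇒ℝ i + β) ◂ v′) x → norm i ≤ ℕ⇒ℝ τ * V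
    norm≤τV i x (2w≤ , _ , slab) = norm≤tail-norm T w ((ℤ⇒ℝ i + β) ◂ v′) x slab 2w≤

    Dτ : ∀ z → ℕ⇒ℝ (D ℕ.* τ) * z ≈ ℕ⇒ℝ D * (ℕ⇒ℝ τ * z)
    Dτ z = trans (*-congʳ (ℕ⇒ℝ-* D τ)) (*-assoc _ _ z)

    1≤Y : 1# ≤ Y
    1≤Y = ≤-trans 1≤₀ (≤-resp refl (sym (Dτ V)) (*-monoʳ-≤ _ (0≤ℕ⇒ℝ D) (norm≤τV i₀ x₀ (2w≤₀ , 1≤₀ , slab₀))))

    0<V : 0# < V
    0<V = ≰⇒> λ V≤0 → 1≰0 (≤-trans 1≤Y (≤-resp refl (zeroʳ _) (*-monoʳ-≤ _ (0≤ℕ⇒ℝ (D ℕ.* τ)) V≤0)))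

    k = proj₁ (maxNorm-attained v′ 0<V)

    V≤∣vₖ∣ : V ≤ ∣ v′ k ∣
    V≤∣vₖ∣ = proj₂ (maxNorm-attained v′ 0<V)

    v′k≉0 : ¬ (v′ k ≈ 0#)
    v′k≉0 eq = <⇒≱ 0<V (≤-trans V≤∣vₖ∣ (≤-reflexive (trans (∣∣-cong eq) (∣ℤ⇒ℝ∣ (+ 0)))))

    u = proj₁ (inverse (v′ k) v′k≉0)

    v′u≈1 : v′ k * u ≈ 1#
    v′u≈1 = proj₂ (inverse (v′ k) v′k≉0)

    V∣u∣≤1 : V * ∣ u ∣ ≤ 1#
    V∣u∣≤1 = ≤-trans (*-monoˡ-≤ ∣ u ∣ (0≤∣x∣ u) V≤∣vₖ∣)
      (≤-reflexive (trans (sym (∣x*y∣ (v′ k) u)) (trans (∣∣-cong (trans v′u≈1 (sym (+-identityʳ 1#))))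
        (trans (∣ℤ⇒ℝ∣ (+ 1)) (+-identityʳ 1#)))))

    ceiling : ∃ λ j → ℕ⇒ℝ j ≤ Y ∧ Y ≤ ℕ⇒ℝ (suc j)
    ceiling =
      let (n , Y≤n) = archimedean Y
          (j , _ , p , q) = locate 1# n Y (≤-trans 0≤1 1≤Y)
            (≤-trans Y≤n (≤-trans (ℕ⇒ℝ-mono (ℕₚ.n≤1+n n)) (≤-reflexive (sym (*-identityʳ _)))))
      in j , ≤-resp (*-identityʳ _) refl p ,
         ≤-resp refl (trans (+-congʳ (*-identityʳ _)) (+-comm _ 1#)) q

    j = proj₁ ceiling
    m = suc j

    diameter : ∀ i i′ → ∃ (Near T w D ((ℤ⇒ℝ i + β) ◂ v′)) → ∃ (Near T w D ((ℤ⇒ℝ i′ + β) ◂ v′)) →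
               ℤ.∣ i ℤ.- i′ ∣ ℕ.≤ m ℕ.+ m
    diameter i i′ (x , near) (x′ , near′) = ℕ⇒ℝ-reflects-≤ _ _ (≤-trans (≤-reflexive (sym (∣ℤ⇒ℝ∣ (i ℤ.- i′))))
      (≤-trans (≤-reflexive (∣∣-cong
          (trans (ℤ⇒ℝ-+ i (ℤ.- i′)) (trans (+-congˡ (ℤ⇒ℝ-neg i′))
            (solve 3 (λ a c b → a :+ :- c := (a :+ b) :+ :- (c :+ b)) refl (ℤ⇒ℝ i) (ℤ⇒ℝ i′) β)))))
        (≤-trans (∣x+y∣≤ _ _) (≤-resp refl (sym (ℕ⇒ℝ-+ m m))
          (+-mono-≤ (half i x near) (≤-trans (≤-reflexive (∣-x∣ _)) (half i′ x′ near′)))))))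
      where
      half : ∀ i x → Near T w D ((ℤ⇒ℝ i + β) ◂ v′) x → ∣ ℤ⇒ℝ i + β ∣ ≤ ℕ⇒ℝ m
      half i x near = ≤-trans (∣x∣≤maxNorm ((ℤ⇒ℝ i + β) ◂ v′) zero) (≤-trans (norm≤τV i x near)
        (≤-trans (≤-resp (*-identityˡ _) (sym (Dτ V))
          (*-monoˡ-≤ _ (*-nonNeg (0≤ℕ⇒ℝ τ) (proj₁ 0<V)) (≤-resp (+-identityʳ 1#) refl (ℕ⇒ℝ-mono 1≤D))))
          (proj₂ (proj₂ ceiling))))

    count≤9Y : ℕ⇒ℝ (suc (m ℕ.+ m ℕ.+ (m ℕ.+ m))) ≤ ℕ⇒ℝ 9 * Y
    count≤9Y = ≤-trans (≤-reflexive (trans (ℕ⇒ℝ-cong (eq j)) (trans (ℕ⇒ℝ-+ 5 (4 ℕ.* j)) (+-congˡ (ℕ⇒ℝ-* 4 j)))))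
      (lin (+-mono-≤ (*-monoʳ-≤ (ℕ⇒ℝ 5) (0≤ℕ⇒ℝ 5) 1≤Y) (*-monoʳ-≤ (ℕ⇒ℝ 4) (0≤ℕ⇒ℝ 4) (proj₁ (proj₂ ceiling))))
        (solve 2 (λ j Y → (con (+ 5) :+ con (+ 4) :* j) :+ (con (+ 5) :* Y :+ con (+ 4) :* Y)
                          := con (+ 9) :* Y :+ (con (+ 5) :* :1 :+ con (+ 4) :* j)) refl (ℕ⇒ℝ j) Y))
      where
      eq : ∀ j → suc (suc j ℕ.+ suc j ℕ.+ (suc j ℕ.+ suc j)) ≡ 5 ℕ.+ 4 ℕ.* j
      eq = ℕ-solve-∀

    cost : ℕ⇒ℝ (suc (m ℕ.+ m ℕ.+ (m ℕ.+ m))) * (ℕ⇒ℝ 4 * (w * ∣ u ∣) * ℕ⇒ℝ P) ≤ ℕ⇒ℝ (line-constant e T ℕ.* D) * w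
    cost = ≤-trans (*-monoˡ-≤ _ (*-nonNeg (*-nonNeg (0≤ℕ⇒ℝ 4) (*-nonNeg (proj₁ 0<w) (0≤∣x∣ u))) (0≤ℕ⇒ℝ P)) count≤9Y)
      (≤-resp
        (solve 5 (λ V u w s p → (con (+ 36) :* s :* p :* w) :* (V :* u)
                   := (con (+ 9) :* (s :* V)) :* (con (+ 4) :* (w :* u) :* p))
           refl V ∣ u ∣ w (ℕ⇒ℝ (D ℕ.* τ)) (ℕ⇒ℝ P))
        (trans (*-identityʳ _) (*-congʳ (sym constant)))
        (*-monoʳ-≤ _ (*-nonNeg (*-nonNeg (*-nonNeg (0≤ℕ⇒ℝ 36) (0≤ℕ⇒ℝ (D ℕ.* τ))) (0≤ℕ⇒ℝ P)) (proj₁ 0<w)) V∣u∣≤1))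
      where
      eq : ∀ c τ P D → c ℕ.* τ ℕ.* P ℕ.* D ≡ c ℕ.* (D ℕ.* τ) ℕ.* P
      eq = ℕ-solve-∀

      constant : ℕ⇒ℝ (line-constant e T ℕ.* D) ≈ ℕ⇒ℝ 36 * ℕ⇒ℝ (D ℕ.* τ) * ℕ⇒ℝ P
      constant = trans (ℕ⇒ℝ-cong (eq 36 τ P D))
        (trans (ℕ⇒ℝ-* (36 ℕ.* (D ℕ.* τ)) P) (*-congʳ (ℕ⇒ℝ-* 36 (D ℕ.* τ))))

  -- Short coefficient vectors in dyadic blocks

  scale : ℕ → ℕ → ℕ → ℕ
  scale n C s = 4 ℕ.* C ℕ.* (2 ℕ.^ s) ℕ.^ n

  1≤scale : ∀ n {C} s → 1 ℕ.≤ C → 1 ℕ.≤ scale n C s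
  1≤scale n {C} s 1≤C = ℕₚ.*-mono-≤ (ℕₚ.*-mono-≤ {1} {4} (s≤s z≤n) 1≤C)
    (ℕₚ.m^n>0 (2 ℕ.^ s) {{ℕₚ.m^n≢0 2 s}} n)

  scale-suc : ∀ n C s → scale n C (suc s) ≡ 2 ℕ.^ n ℕ.* scale n C s
  scale-suc n C s = ≡.trans (≡.cong (4 ℕ.* C ℕ.*_) (^-distribʳ-* n 2 (2 ℕ.^ s)))
    (eq (4 ℕ.* C) (2 ℕ.^ n) ((2 ℕ.^ s) ℕ.^ n))
    where
    eq : ∀ a b c → a ℕ.* (b ℕ.* c) ≡ b ℕ.* (a ℕ.* c)
    eq = ℕ-solve-∀

  1≤∣ℤ⇒ℝ∣ : ∀ i → i ≢ ℤ.0ℤ → 1# ≤ ∣ ℤ⇒ℝ i ∣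
  1≤∣ℤ⇒ℝ∣ i i≢0 = ≤-resp refl (sym (∣ℤ⇒ℝ∣ i))
    (1≤ℕ⇒ℝ ℤ.∣ i ∣ {{≢-nonZero (i≢0 ∘ ℤₚ.∣i∣≡0⇒i≡0)}})

  1≤norm-integral : ∀ {n} (α : Vector ℝ n) p i → p i ≢ ℤ.0ℤ → 1# ≤ maxNorm (point α ℤ.0ℤ p)
  1≤norm-integral α p i pᵢ≢0 = ≤-trans (1≤∣ℤ⇒ℝ∣ (p i) pᵢ≢0)
    (≤-trans (≤-reflexive (∣∣-cong (solve 2 (λ p a → p := p :+ a :* :0) refl (ℤ⇒ℝ (p i)) (α i))))
      (∣x∣≤maxNorm (point α ℤ.0ℤ p) i))

  norm-point-sub : ∀ {n} (α : Vector ℝ n) q q′ p p′ →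
    maxNorm (point α (q ℤ.- q′) (λ i → p i ℤ.- p′ i)) ≤ maxNorm (point α q p) + maxNorm (point α q′ p′)
  norm-point-sub α q q′ p p′ = maxNorm-least _ (0≤x+y (0≤maxNorm (point α q p)) (0≤maxNorm (point α q′ p′))) λ i →
    ≤-trans (≤-reflexive (∣∣-cong (trans
        (+-cong (trans (ℤ⇒ℝ-+ (p i) _) (+-congˡ (ℤ⇒ℝ-neg (p′ i))))
                (*-congˡ (trans (ℤ⇒ℝ-+ q _) (+-congˡ (ℤ⇒ℝ-neg q′)))))
        (solve 5 (λ p p′ a q q′ → (p :+ :- p′) :+ a :* (q :+ :- q′) := (p :+ a :* q) :+ :- (p′ :+ a :* q′)) refl
          (ℤ⇒ℝ (p i)) (ℤ⇒ℝ (p′ i)) (α i) (ℤ⇒ℝ q) (ℤ⇒ℝ q′)))))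
    (≤-trans (∣x+y∣≤ _ _)
      (+-mono-≤ (∣x∣≤maxNorm (point α q p) i)
        (≤-trans (≤-reflexive (∣-x∣ _)) (∣x∣≤maxNorm (point α q′ p′) i))))

  -- By bad approximability a nonzero difference of two such points would have
  -- norm at least 4 / scale n C s, whereas it is at most 2 / scale n C s.
  separation : ∀ {n} (α : Vector ℝ n) C s → 1 ℕ.≤ C → BadlyApproximable α C → ∀ q q′ p p′ →
    ℤ.∣ q ℤ.- q′ ∣ ℕ.≤ 2 ℕ.^ s →
    ℕ⇒ℝ (scale n C s) * maxNorm (point α q p) ≤ 1# →
    ℕ⇒ℝ (scale n C s) * maxNorm (point α q′ p′) ≤ 1# →
    q ≡ q′ ∧ p ≗ p′
  separation {n} α C s 1≤C bad q q′ p p′ close small small′ = q≡q′ , p≗p′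
    where
    ρ : Vector ℤ n
    ρ i = p i ℤ.- p′ i

    D : ℕ
    D = scale n C s

    D*norm≤2 : ℕ⇒ℝ D * maxNorm (point α (q ℤ.- q′) ρ) ≤ 2#
    D*norm≤2 = ≤-trans (*-monoʳ-≤ _ (0≤ℕ⇒ℝ D) (norm-point-sub α q q′ p p′))
      (≤-resp (sym (distribˡ _ _ _)) (+-congˡ (sym (+-identityʳ 1#))) (+-mono-≤ small small′))

    4≰2 : ¬ (ℕ⇒ℝ 4 ≤ 2#)
    4≰2 le = case ℕ⇒ℝ-reflects-≤ 4 2 le of λ { (s≤s (s≤s ())) }

    contradict : ∀ m → 4 ℕ.* m ℕ.≤ D → ¬ (1# ≤ ℕ⇒ℝ m * maxNorm (point α (q ℤ.- q′) ρ))
    contradict m 4m≤D 1≤ = 4≰2 (≤-trans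
      (≤-resp (*-identityʳ _) (trans (sym (*-assoc _ _ _)) (*-congʳ (sym (ℕ⇒ℝ-* 4 m))))
        (*-monoʳ-≤ (ℕ⇒ℝ 4) (0≤ℕ⇒ℝ 4) 1≤))
      (≤-trans (*-monoˡ-≤ _ (0≤maxNorm (point α (q ℤ.- q′) ρ)) (ℕ⇒ℝ-mono 4m≤D)) D*norm≤2))

    q≡q′ : q ≡ q′
    q≡q′ with q ℤₚ.≟ q′
    ... | yes eq   = eq
    ... | no q≢q′ = ⊥-elim (contradict (C ℕ.* ℤ.∣ q ℤ.- q′ ∣ ℕ.^ n)
      (ℕₚ.≤-trans (ℕₚ.≤-reflexive (≡.sym (ℕₚ.*-assoc 4 C _)))
        (ℕₚ.*-monoʳ-≤ (4 ℕ.* C) (ℕₚ.^-monoˡ-≤ n close)))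
      (bad (q ℤ.- q′) ρ (q≢q′ ∘ ℤₚ.i-j≡0⇒i≡j q q′)))

    p≗p′ : p ≗ p′
    p≗p′ i with p i ℤₚ.≟ p′ i
    ... | yes eq     = eq
    -- Once `q` equals `q′` the difference is an integer vector, so a nonzero entry makes its norm
    -- at least 1; hence the multiplier 1.
    ... | no pᵢ≢p′ᵢ = ⊥-elim (contradict 1
      (ℕₚ.*-mono-≤ (ℕₚ.*-monoʳ-≤ 4 1≤C) (ℕₚ.m^n>0 (2 ℕ.^ s) {{ℕₚ.m^n≢0 2 s}} n))
      (≤-resp refl (sym (trans (*-congʳ (+-identityʳ 1#)) (*-identityˡ _)))
        (≡.subst (λ r → 1# ≤ maxNorm (point α r ρ)) (≡.sym (ℤₚ.i≡j⇒i-j≡0 q≡q′))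
          (1≤norm-integral α ρ i (pᵢ≢p′ᵢ ∘ ℤₚ.i-j≡0⇒i≡j (p i) (p′ i))))))

  module Dyadic {e} (α : Vector ℝ (suc (suc e))) (C : ℕ) (1≤C : 1 ℕ.≤ C) (bad : BadlyApproximable α C)
                (T N : ℕ) (w : ℝ) (0<w : 0# < w) where
    n : ℕ
    n = suc (suc e)

    -- The threshold has index `suc s` although the length has exponent `s`: these are the vectors
    -- that remain for a half after the short one of the block of length `2 ^ suc s` has been taken
    -- out.
    Block : ℕ → ℤ → Pred (Vector ℝ (suc e)) 0ℓ
    Block s a x = ∃ λ i → i ℕ.< 2 ℕ.^ s ∧ ∃ λ p → (∀ j → ℤ.∣ p (suc j) ∣ ℕ.≤ N) ∧
      Near T w (scale n C (suc s)) (point α (a ℤ.+ + i) p) x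

    K : ℕ
    K = line-constant e T

    M : ℕ
    M = suc (N ℕ.+ N) ℕ.^ suc e

    -- A block of length 1 pays for each of the `M` tails. In the recursion the last summand pays
    -- for the one short vector, whose norm is only known to be at least
    -- `1 / scale n C (suc (suc s))`.
    blockCost : ℕ → ℕ
    blockCost zero    = M ℕ.* (K ℕ.* scale n C 1)
    blockCost (suc s) = blockCost s ℕ.+ blockCost s ℕ.+ K ℕ.* scale n C (suc (suc s))

    tail-cover : ∀ q (p′ : Vector ℤ (suc e)) D → 1 ℕ.≤ D →
      Cover (λ x → ∃ λ p → tail p ≗ p′ ∧ Near T w D (point α q p) x) (ℕ⇒ℝ (K ℕ.* D) * w)
    tail-cover q p′ D 1≤D = cover-mono
      (λ { x (p , eq , near) → p zero , Near-resp T w D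
             {point α q p} {(ℤ⇒ℝ (p zero) + α zero * ℤ⇒ℝ q) ◂ point (tail α) q p′} x
             (λ { zero → refl ; (suc j) → +-congʳ (reflexive (≡.cong ℤ⇒ℝ (eq j))) }) near })
      ≤-refl
      (line-cover T w D (α zero * ℤ⇒ℝ q) (point (tail α) q p′) 0<w 1≤D)

    -- Among the q of a block of length 2 ^ s, all but at most one point are
    -- longer than 1 / scale n C s and hence belong to one of the two halves.
    block-cover : ∀ s a → Cover (Block s a) (ℕ⇒ℝ (blockCost s) * w)
    block-cover zero a = cover-mono
      (λ { x (zero , _ , p , p≤N , near) → tail p , p≤N , p , (λ _ → ≡.refl) , near
         ; x (suc i , s≤s () , _) })
      (≤-reflexive (trans (sym (*-assoc _ _ w)) (*-congʳ (sym (ℕ⇒ℝ-* M (K ℕ.* scale n C 1))))))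
      (cover-⋃-cube (suc e) N
        {λ p′ x → ∃ λ p → tail p ≗ p′ ∧ Near T w (scale n C 1) (point α (a ℤ.+ + 0) p) x}
        (λ x eq → λ { (p , eq′ , near) → p , (λ j → ≡.trans (eq′ j) (eq j)) , near })
        (λ p′ → tail-cover (a ℤ.+ + 0) p′ (scale n C 1) (1≤scale n 1 1≤C)))
    block-cover (suc s) a = cover-mono (λ _ x∈ → x∈)
      (≤-reflexive (sym (trans
        (*-congʳ (trans (ℕ⇒ℝ-+ (blockCost s ℕ.+ blockCost s) _) (+-congʳ (ℕ⇒ℝ-+ (blockCost s) _))))
        (trans (distribʳ w _ _) (+-congʳ (distribʳ w _ _))))))
      (cover-∪ split
        (cover-∪ (λ _ x∈ → x∈) (block-cover s a) (block-cover s (a ℤ.+ + (2 ℕ.^ s))))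
        short-cover)
      where
      D D′ : ℕ
      D  = scale n C (suc s)
      D′ = scale n C (suc (suc s))

      Short : Pred (Vector ℝ (suc e)) 0ℓ
      Short x = ∃ λ i → i ℕ.< 2 ℕ.^ suc s ∧ ∃ λ p →
        ℕ⇒ℝ D * maxNorm (point α (a ℤ.+ + i) p) ≤ 1# ∧ Near T w D′ (point α (a ℤ.+ + i) p) x

      split : ∀ x → Block (suc s) a x → (Block s a x ⊎ Block s (a ℤ.+ + (2 ℕ.^ s)) x) ⊎ Short x
      split x (i , i< , p , p≤N , near@(2w≤ , _ , slab))
        with ≤-total (ℕ⇒ℝ D * maxNorm (point α (a ℤ.+ + i) p)) 1#
      ... | inj₁ small = inj₂ (i , i< , p , small , near)
      ... | inj₂ large with i ℕₚ.<? 2 ℕ.^ s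
      ...   | yes i<2^s = inj₁ (inj₁ (i , i<2^s , p , p≤N , 2w≤ , large , slab))
      ...   | no  i≮2^s = inj₁ (inj₂ (i ℕ.∸ 2 ℕ.^ s , i′< , p , p≤N ,
                ≡.subst (λ q → Near T w D (point α q p) x) shift (2w≤ , large , slab)))
        where
        shift : a ℤ.+ + i ≡ a ℤ.+ + (2 ℕ.^ s) ℤ.+ + (i ℕ.∸ 2 ℕ.^ s)
        shift = ≡.sym (≡.trans (ℤₚ.+-assoc a _ _) (≡.cong (λ k → a ℤ.+ + k) (ℕₚ.m+[n∸m]≡n (ℕₚ.≮⇒≥ i≮2^s))))

        i′< : i ℕ.∸ 2 ℕ.^ s ℕ.< 2 ℕ.^ s
        i′< = ℕₚ.+-cancelˡ-< (2 ℕ.^ s) _ _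
          (≡.subst (ℕ._< 2 ℕ.^ s ℕ.+ 2 ℕ.^ s) (≡.sym (ℕₚ.m+[n∸m]≡n (ℕₚ.≮⇒≥ i≮2^s)))
            (≡.subst (i ℕ.<_) (≡.cong (2 ℕ.^ s ℕ.+_) (ℕₚ.+-identityʳ _)) i<))

      close : ∀ i i′ → i ℕ.< 2 ℕ.^ suc s → i′ ℕ.< 2 ℕ.^ suc s →
              ℤ.∣ (a ℤ.+ + i) ℤ.- (a ℤ.+ + i′) ∣ ℕ.≤ 2 ℕ.^ suc s
      close i i′ i< i′< = ≡.subst (ℕ._≤ 2 ℕ.^ suc s) (≡.cong ℤ.∣_∣ (≡.sym difference))
        (ℕₚ.≤-trans (ℤₚ.∣m⊝n∣≤m⊔n i i′) (ℕₚ.⊔-lub (ℕₚ.<⇒≤ i<) (ℕₚ.<⇒≤ i′<)))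
        where
        difference : (a ℤ.+ + i) ℤ.- (a ℤ.+ + i′) ≡ i ℤ.⊖ i′
        difference = ≡.trans (eq a (+ i) (+ i′)) (ℤₚ.m-n≡m⊖n i i′)
          where
          eq : ∀ a x y → (a ℤ.+ x) ℤ.- (a ℤ.+ y) ≡ x ℤ.- y
          eq = ℤ-solve-∀

      short-cover : Cover Short (ℕ⇒ℝ (K ℕ.* D′) * w)
      short-cover with em {∃ Short}
      ... | no empty = cover-∅ (λ x x∈ → empty (x , x∈)) (*-nonNeg (0≤ℕ⇒ℝ (K ℕ.* D′)) (proj₁ 0<w))
      ... | yes (_ , i₀ , i₀< , p₀ , small₀ , _) =
        cover-mono same ≤-refl (tail-cover (a ℤ.+ + i₀) (tail p₀) D′ (1≤scale n (suc (suc s)) 1≤C))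
        where
        same : ∀ x → Short x → ∃ λ p → tail p ≗ tail p₀ ∧ Near T w D′ (point α (a ℤ.+ + i₀) p) x
        same x (i , i< , p , small , near) =
          let (q≡q₀ , p≗p₀) = separation α C (suc s) 1≤C bad (a ℤ.+ + i) (a ℤ.+ + i₀) p p₀
                                (close i i₀ i< i₀<) small small₀
          in p , p≗p₀ ∘ suc , ≡.subst (λ q → Near T w D′ (point α q p) x) q≡q₀ near

  -- Total volume of the slabs at one level

  ball-index : ∀ N q → ℤ.∣ q ∣ ℕ.≤ N → ∃ λ i → i ℕ.≤ N ℕ.+ N ∧ q ≡ ℤ.- (+ N) ℤ.+ + i
  ball-index N (+ k) k≤N = N ℕ.+ k , ℕₚ.+-monoʳ-≤ N k≤N , ≡.sym (eq (+ N) (+ k))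
    where
    eq : ∀ a b → ℤ.- a ℤ.+ (a ℤ.+ b) ≡ b
    eq = ℤ-solve-∀
  ball-index N -[1+ k ] k<N = N ℕ.∸ suc k , ℕₚ.≤-trans (ℕₚ.m∸n≤m N (suc k)) (ℕₚ.m≤m+n N N) ,
    ≡.sym (≡.trans (≡.cong (λ j → ℤ.- (+ N) ℤ.+ j)
      (≡.trans (≡.sym (ℤₚ.⊖-≥ k<N)) (≡.sym (ℤₚ.m-n≡m⊖n N (suc k))))) (eq (+ N) (+ suc k)))
    where
    eq : ∀ a b → ℤ.- a ℤ.+ (a ℤ.- b) ≡ ℤ.- b
    eq = ℤ-solve-∀

  -- The constant term `p zero` is left out on purpose: in the application `q` and the other entries
  -- make up the given integer vector, and it is this vector that is nonzero.
  Nontrivial : ∀ {d} → ℤ → Vector ℤ (suc d) → Set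
  Nontrivial q p = q ≢ ℤ.0ℤ ⊎ (∃ λ j → p (suc j) ≢ ℤ.0ℤ)

  Level : ∀ {d} → Vector ℝ (suc d) → ℕ → ℕ → ℝ → Pred (Vector ℝ d) 0ℓ
  Level α T N w x = ∃ λ q → ∃ λ p → Nontrivial q p ∧ ℤ.∣ q ∣ ℕ.≤ N ∧
    (∀ j → ℤ.∣ p (suc j) ∣ ℕ.≤ N) ∧ Slab T w (point α q p) x

  -- If `q` is 0, bad approximability says nothing, but then the vector is integral with a nonzero
  -- entry.
  1≤scaled-norm : ∀ {d} (α : Vector ℝ (suc d)) {C} → 1 ℕ.≤ C → BadlyApproximable α C →
    ∀ N q p → 1 ℕ.≤ N → Nontrivial q p → ℤ.∣ q ∣ ℕ.≤ N →
    1# ≤ ℕ⇒ℝ (C ℕ.* N ℕ.^ suc d) * maxNorm (point α q p)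
  1≤scaled-norm {d} α {C} 1≤C bad N q p 1≤N nontrivial q≤N with q ℤₚ.≟ ℤ.0ℤ
  ... | no q≢0 = ≤-trans (bad q p q≢0)
    (*-monoˡ-≤ _ (0≤maxNorm (point α q p)) (ℕ⇒ℝ-mono (ℕₚ.*-monoʳ-≤ C (ℕₚ.^-monoˡ-≤ (suc d) q≤N))))
  ... | yes ≡.refl with nontrivial
  ...   | inj₁ q≢0         = ⊥-elim (q≢0 ≡.refl)
  ...   | inj₂ (j , pⱼ≢0) = ≤-trans (1≤norm-integral α p (suc j) pⱼ≢0)
    (≤-resp (*-identityˡ _) refl (*-monoˡ-≤ _ (0≤maxNorm (point α q p))
      (≤-resp (+-identityʳ 1#) refl (ℕ⇒ℝ-mono
        (ℕₚ.*-mono-≤ 1≤C (ℕₚ.m^n>0 N {{ℕ.>-nonZero 1≤N}} (suc d)))))))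

  2w≤norm : ∀ D {w m} → ℕ⇒ℝ (2 ℕ.* D) * w ≤ 1# → 1# ≤ ℕ⇒ℝ D * m → 2# * w ≤ m
  2w≤norm D {w} {m} 2Dw≤1 1≤Dm = *-cancelˡ-≤ 0<D
    (≤-trans (≤-reflexive (trans (solve 2 (λ d w → d :* (:2 :* w) := (:2 :* d) :* w) refl (ℕ⇒ℝ D) w)
      (*-congʳ (sym (ℕ⇒ℝ-* 2 D))))) (≤-trans 2Dw≤1 1≤Dm))
    where
    0<D : 0# < ℕ⇒ℝ D
    0<D = ≰⇒> λ D≤0 → 1≰0 (≤-trans 1≤Dm (≤-reflexive (trans (*-congʳ (≤-antisym D≤0 (0≤ℕ⇒ℝ D))) (zeroˡ m))))

  -- One quantity is both the smallness condition on `w` and the cost, so once the costs are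
  -- summable the condition holds from some level on.
  LevelCost : ∀ {d} → Vector ℝ (suc d) → ℕ → ℕ → Set
  LevelCost {d} α T Φ = ∀ h w → 0# < w → ℕ⇒ℝ (Φ ℕ.* (2 ℕ.^ h) ℕ.^ suc d) * w ≤ 1# →
    Cover (Level α T (2 ℕ.^ h) w) (ℕ⇒ℝ (Φ ℕ.* (2 ℕ.^ h) ℕ.^ suc d) * w)

  -- The tail of `v` is empty, so `norm≤tail-norm` would make the norm vanish, against `2 w ≤ ‖v‖`
  -- with `w` positive. The covering must be the empty list, since every box of dimension 0 has
  -- volume 1.
  level-cover-0 : (α : Vector ℝ 1) (C : ℕ) → 1 ℕ.≤ C → BadlyApproximable α C → ∀ T → LevelCost α T (2 ℕ.* C)
  level-cover-0 α C 1≤C bad T h w 0<w small = cover-∅ empty (*-nonNeg (0≤ℕ⇒ℝ (2 ℕ.* C ℕ.* N ℕ.^ 1)) (proj₁ 0<w))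
    where
    N = 2 ℕ.^ h
    empty : ∀ x → ¬ Level α T N w x
    empty x (q , p , nontrivial , q≤N , _ , slab) = <⇒≱ 0<w (*-cancelˡ-≤ (0<ℕ⇒ℝ 2)
      (≤-trans 2w≤ (≤-trans (norm≤tail-norm T w (point α q p) x slab 2w≤)
        (≤-reflexive (trans (zeroʳ _) (sym (zeroʳ 2#)))))))
      where
      2w≤ : 2# * w ≤ maxNorm (point α q p)
      2w≤ = 2w≤norm (C ℕ.* N ℕ.^ 1)
        (≤-resp (*-congʳ (ℕ⇒ℝ-cong (ℕₚ.*-assoc 2 C (N ℕ.^ 1)))) refl small)
        (1≤scaled-norm α 1≤C bad N q p (ℕₚ.m^n>0 2 h) nontrivial q≤N)

  module DyadicCost {e} (α : Vector ℝ (suc (suc e))) (C : ℕ) (1≤C : 1 ℕ.≤ C) (bad : BadlyApproximable α C) (T : ℕ) where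

    private
      n K : ℕ
      n = suc (suc e)
      K = line-constant e T

      module D = Dyadic α C 1≤C bad T

    -- Here `n ≥ 2` enters. The recursion doubles the old error term to `4 * K * D₁`, while `scale`
    -- grows by `2 ^ n ≥ 4`, so this is at most `K * D₂`; adding the new `K * D₂` reproduces the
    -- constant 2.
    blockCost≤ : ∀ N w (0<w : 0# < w) s →
      D.blockCost N w 0<w s ℕ.≤ 2 ℕ.^ s ℕ.* D.blockCost N w 0<w 0 ℕ.+ 2 ℕ.* K ℕ.* scale n C (suc s)
    blockCost≤ N w 0<w zero = ℕₚ.≤-trans (ℕₚ.≤-reflexive (≡.sym (ℕₚ.*-identityˡ _))) (ℕₚ.m≤m+n _ _)
    blockCost≤ N w 0<w (suc s) = begin
      g s ℕ.+ g s ℕ.+ K ℕ.* D₂                           ≤⟨ ℕₚ.+-monoˡ-≤ (K ℕ.* D₂) (ℕₚ.+-mono-≤ ih ih) ⟩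
      (b ℕ.+ 2 ℕ.* K ℕ.* D₁) ℕ.+ (b ℕ.+ 2 ℕ.* K ℕ.* D₁) ℕ.+ K ℕ.* D₂
                                                         ≡⟨ eq₁ (2 ℕ.^ s) (g 0) K D₁ D₂ ⟩
      2 ℕ.* 2 ℕ.^ s ℕ.* g 0 ℕ.+ (K ℕ.* (4 ℕ.* D₁) ℕ.+ K ℕ.* D₂)
                                                         ≤⟨ ℕₚ.+-monoʳ-≤ (2 ℕ.* 2 ℕ.^ s ℕ.* g 0) (ℕₚ.+-monoˡ-≤ (K ℕ.* D₂) (ℕₚ.*-monoʳ-≤ K 4D₁≤D₂)) ⟩
      2 ℕ.* 2 ℕ.^ s ℕ.* g 0 ℕ.+ (K ℕ.* D₂ ℕ.+ K ℕ.* D₂)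
                                                         ≡⟨ eq₂ (2 ℕ.* 2 ℕ.^ s ℕ.* g 0) K D₂ ⟩
      2 ℕ.^ suc s ℕ.* g 0 ℕ.+ 2 ℕ.* K ℕ.* D₂             ∎
      where
      open ℕₚ.≤-Reasoning
      g = D.blockCost N w 0<w
      D₁ D₂ b : ℕ
      D₁ = scale n C (suc s)
      D₂ = scale n C (suc (suc s))
      b  = 2 ℕ.^ s ℕ.* g 0
      ih = blockCost≤ N w 0<w s

      eq₁ : ∀ t g K D₁ D₂ → (t ℕ.* g ℕ.+ 2 ℕ.* K ℕ.* D₁) ℕ.+ (t ℕ.* g ℕ.+ 2 ℕ.* K ℕ.* D₁) ℕ.+ K ℕ.* D₂
                            ≡ 2 ℕ.* t ℕ.* g ℕ.+ (K ℕ.* (4 ℕ.* D₁) ℕ.+ K ℕ.* D₂)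
      eq₁ = ℕ-solve-∀

      eq₂ : ∀ t K D → t ℕ.+ (K ℕ.* D ℕ.+ K ℕ.* D) ≡ t ℕ.+ 2 ℕ.* K ℕ.* D
      eq₂ = ℕ-solve-∀

      4D₁≤D₂ : 4 ℕ.* D₁ ℕ.≤ D₂
      4D₁≤D₂ = ℕₚ.≤-trans (ℕₚ.*-monoˡ-≤ D₁ (ℕₚ.^-monoʳ-≤ 2 {2} {n} (s≤s (s≤s z≤n))))
        (ℕₚ.≤-reflexive (≡.sym (scale-suc n C (suc s))))

    -- Coefficients of `N ^ n` for `N = 2 ^ h`: the block has length `4 * N` and at most
    -- `(3 * N) ^ suc e` tails, and `scale n C (3 + h)` is `4 * C * 8 ^ n * N ^ n`. The threshold is
    -- what `2w≤norm` asks for at that scale.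
    countConstant thresholdConstant levelConstant : ℕ
    countConstant     = 4 ℕ.* 3 ℕ.^ suc e ℕ.* (K ℕ.* scale n C 1) ℕ.+ 8 ℕ.* K ℕ.* C ℕ.* 8 ℕ.^ n
    thresholdConstant = 8 ℕ.* C ℕ.* 8 ℕ.^ n
    levelConstant     = countConstant ℕ.+ thresholdConstant

    scale-shift : ∀ h → scale n C (3 ℕ.+ h) ≡ 4 ℕ.* C ℕ.* (8 ℕ.^ n ℕ.* (2 ℕ.^ h) ℕ.^ n)
    scale-shift h = ≡.cong (4 ℕ.* C ℕ.*_)
      (≡.trans (≡.cong (ℕ._^ n) (eq (2 ℕ.^ h))) (^-distribʳ-* n 8 (2 ℕ.^ h)))
      where
      eq : ∀ a → 2 ℕ.* (2 ℕ.* (2 ℕ.* a)) ≡ 8 ℕ.* a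
      eq = ℕ-solve-∀

    blockCost≤levelConstant : ∀ h w (0<w : 0# < w) →
      D.blockCost (2 ℕ.^ h) w 0<w (2 ℕ.+ h) ℕ.≤ levelConstant ℕ.* (2 ℕ.^ h) ℕ.^ n
    blockCost≤levelConstant h w 0<w = begin
      D.blockCost N w 0<w (2 ℕ.+ h)                      ≤⟨ blockCost≤ N w 0<w (2 ℕ.+ h) ⟩
      2 ℕ.^ (2 ℕ.+ h) ℕ.* (M ℕ.* A) ℕ.+ 2 ℕ.* K ℕ.* scale n C (3 ℕ.+ h)
        ≤⟨ ℕₚ.+-mono-≤ (ℕₚ.*-monoʳ-≤ (2 ℕ.^ (2 ℕ.+ h)) (ℕₚ.*-monoˡ-≤ A M≤))
             (ℕₚ.≤-reflexive (≡.cong (2 ℕ.* K ℕ.*_) (scale-shift h))) ⟩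
      2 ℕ.^ (2 ℕ.+ h) ℕ.* (3 ℕ.^ suc e ℕ.* N ℕ.^ suc e ℕ.* A) ℕ.+ 2 ℕ.* K ℕ.* (4 ℕ.* C ℕ.* (8 ℕ.^ n ℕ.* N ℕ.^ n))
        ≡⟨ eq N (3 ℕ.^ suc e) (N ℕ.^ suc e) A K C (8 ℕ.^ n) ⟩
      (4 ℕ.* 3 ℕ.^ suc e ℕ.* A ℕ.+ 8 ℕ.* K ℕ.* C ℕ.* 8 ℕ.^ n) ℕ.* N ℕ.^ n
        ≤⟨ ℕₚ.*-monoˡ-≤ (N ℕ.^ n) (ℕₚ.m≤m+n countConstant thresholdConstant) ⟩
      levelConstant ℕ.* N ℕ.^ n                          ∎
      where
      open ℕₚ.≤-Reasoning
      N M A : ℕ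
      N = 2 ℕ.^ h
      M = suc (N ℕ.+ N) ℕ.^ suc e
      A = K ℕ.* scale n C 1

      M≤ : M ℕ.≤ 3 ℕ.^ suc e ℕ.* N ℕ.^ suc e
      M≤ = ℕₚ.≤-trans
        (ℕₚ.^-monoˡ-≤ (suc e) (ℕₚ.≤-trans (ℕₚ.+-monoˡ-≤ (N ℕ.+ N) (ℕₚ.m^n>0 2 h)) (ℕₚ.≤-reflexive (3N N))))
        (ℕₚ.≤-reflexive (^-distribʳ-* (suc e) 3 N))
        where
        3N : ∀ N → N ℕ.+ (N ℕ.+ N) ≡ 3 ℕ.* N
        3N = ℕ-solve-∀

      eq : ∀ N t P A K C u → 2 ℕ.* (2 ℕ.* N) ℕ.* (t ℕ.* P ℕ.* A) ℕ.+ 2 ℕ.* K ℕ.* (4 ℕ.* C ℕ.* (u ℕ.* (N ℕ.* P)))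
           ≡ (4 ℕ.* t ℕ.* A ℕ.+ 8 ℕ.* K ℕ.* C ℕ.* u) ℕ.* (N ℕ.* P)
      eq = ℕ-solve-∀

    2scale≤levelConstant : ∀ h → 2 ℕ.* scale n C (3 ℕ.+ h) ℕ.≤ levelConstant ℕ.* (2 ℕ.^ h) ℕ.^ n
    2scale≤levelConstant h = ℕₚ.≤-trans
      (ℕₚ.≤-reflexive (≡.trans (≡.cong (2 ℕ.*_) (scale-shift h)) (eq C (8 ℕ.^ n) ((2 ℕ.^ h) ℕ.^ n))))
      (ℕₚ.*-monoˡ-≤ ((2 ℕ.^ h) ℕ.^ n) (ℕₚ.m≤n+m thresholdConstant countConstant))
      where
      eq : ∀ C u P → 2 ℕ.* (4 ℕ.* C ℕ.* (u ℕ.* P)) ≡ 8 ℕ.* C ℕ.* u ℕ.* P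
      eq = ℕ-solve-∀

    level-cover-suc : LevelCost α T levelConstant
    level-cover-suc h w 0<w small = cover-mono inc
      (*-monoˡ-≤ w (proj₁ 0<w) (ℕ⇒ℝ-mono (blockCost≤levelConstant h w 0<w)))
      -- The `2 * N + 1` integers of the ball do not fit into a block of length `2 * N`, hence the
      -- exponent `2 + h`.
      (D.block-cover N w 0<w (2 ℕ.+ h) (ℤ.- (+ N)))
      where
      N D₃ : ℕ
      N  = 2 ℕ.^ h
      D₃ = scale n C (3 ℕ.+ h)

      1≤N : 1 ℕ.≤ N
      1≤N = ℕₚ.m^n>0 2 h

      CNⁿ≤D₃ : C ℕ.* N ℕ.^ n ℕ.≤ D₃
      CNⁿ≤D₃ = ℕₚ.*-mono-≤ (ℕₚ.m≤n*m C 4)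
        (ℕₚ.^-monoˡ-≤ n (ℕₚ.^-monoʳ-≤ 2 (ℕₚ.m≤n+m h 3)))

      2N<4N : N ℕ.+ N ℕ.< 2 ℕ.^ (2 ℕ.+ h)
      2N<4N = ℕₚ.<-≤-trans (ℕₚ.m<m+n (N ℕ.+ N) (ℕₚ.≤-trans 1≤N (ℕₚ.m≤m+n N N))) (ℕₚ.≤-reflexive (eq N))
        where
        eq : ∀ N → N ℕ.+ N ℕ.+ (N ℕ.+ N) ≡ 2 ℕ.* (2 ℕ.* N)
        eq = ℕ-solve-∀

      inc : ∀ x → Level α T N w x → D.Block N w 0<w (2 ℕ.+ h) (ℤ.- (+ N)) x
      inc x (q , p , nontrivial , q≤N , p≤N , slab) =
        let (i , i≤ , q≡) = ball-index N q q≤N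
        in i , ℕₚ.≤-<-trans i≤ 2N<4N , p , p≤N ,
           ≡.subst (λ r → Near T w D₃ (point α r p) x) q≡ (2w≤norm D₃ 2D₃w≤1 1≤ , 1≤ , slab)
        where
        1≤ : 1# ≤ ℕ⇒ℝ D₃ * maxNorm (point α q p)
        1≤ = ≤-trans (1≤scaled-norm α 1≤C bad N q p 1≤N nontrivial q≤N)
          (*-monoˡ-≤ _ (0≤maxNorm (point α q p)) (ℕ⇒ℝ-mono CNⁿ≤D₃))

        2D₃w≤1 : ℕ⇒ℝ (2 ℕ.* D₃) * w ≤ 1#
        2D₃w≤1 = ≤-trans (*-monoˡ-≤ w (proj₁ 0<w) (ℕ⇒ℝ-mono (2scale≤levelConstant h))) small

  level-cover : ∀ {d} (α : Vector ℝ (suc d)) C → 1 ℕ.≤ C → BadlyApproximable α C → ∀ T → ∃ (LevelCost α T)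
  level-cover {zero}  α C 1≤C bad T = 2 ℕ.* C , level-cover-0 α C 1≤C bad T
  level-cover {suc e} α C 1≤C bad T = DyadicCost.levelConstant α C 1≤C bad T , DyadicCost.level-cover-suc α C 1≤C bad T

  -- Series

  partialSum-+ : ∀ f M N → partialSum f (M ℕ.+ N) ≈ partialSum f M + partialSum (λ k → f (M ℕ.+ k)) N
  partialSum-+ f zero    N = sym (+-identityˡ _)
  partialSum-+ f (suc M) N = trans (+-congˡ (partialSum-+ (f ∘ suc) M N)) (sym (+-assoc _ _ _))

  partialSum-suc : ∀ f N → partialSum f (suc N) ≈ partialSum f N + f N
  partialSum-suc f zero    = trans (+-identityʳ _) (sym (+-identityˡ _))
  partialSum-suc f (suc N) = trans (+-congˡ (partialSum-suc (f ∘ suc) N)) (sym (+-assoc _ _ _))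

  partialSum-mono : ∀ {f g} N → (∀ k → k ℕ.< N → f k ≤ g k) → partialSum f N ≤ partialSum g N
  partialSum-mono zero    f≤g = ≤-refl
  partialSum-mono (suc N) f≤g = +-mono-≤ (f≤g 0 (s≤s z≤n)) (partialSum-mono N (λ k k<N → f≤g (suc k) (s≤s k<N)))

  partialSum-scale : ∀ c f N → partialSum (λ k → c * f k) N ≈ c * partialSum f N
  partialSum-scale c f zero    = sym (zeroʳ c)
  partialSum-scale c f (suc N) = trans (+-congˡ (partialSum-scale c (f ∘ suc) N)) (sym (distribˡ c _ _))

  partialSum-const : ∀ c N → partialSum (λ _ → c) N ≈ ℕ⇒ℝ N * c
  partialSum-const c zero    = sym (zeroˡ c)
  partialSum-const c (suc N) = trans (+-cong (sym (*-identityˡ c)) (partialSum-const c N)) (sym (distribʳ c _ _))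

  partialSum-nonNeg : ∀ {f} N → (∀ k → 0# ≤ f k) → 0# ≤ partialSum f N
  partialSum-nonNeg zero    0≤f = ≤-refl
  partialSum-nonNeg (suc N) 0≤f = 0≤x+y (0≤f 0) (partialSum-nonNeg N (0≤f ∘ suc))

  partialSum-monoˡ : ∀ {f M N} → (∀ k → 0# ≤ f k) → M ℕ.≤ N → partialSum f M ≤ partialSum f N
  partialSum-monoˡ {N = N} 0≤f z≤n = partialSum-nonNeg N 0≤f
  partialSum-monoˡ 0≤f (s≤s M≤N)   = +-monoʳ-≤ _ (partialSum-monoˡ (0≤f ∘ suc) M≤N)

  term≤partialSum : ∀ {f} k → (∀ j → 0# ≤ f j) → f k ≤ partialSum f (suc k)
  term≤partialSum {f} k 0≤f = ≤-resp (+-identityˡ _) (sym (partialSum-suc f k)) (+-monoˡ-≤ (f k) (partialSum-nonNeg k 0≤f))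

  -- Some partial sum comes within `ε` of the supremum of all of them, which leaves the later terms
  -- no more room than that.
  small-tail : ∀ a b → (∀ k → 0# ≤ a k) → (∀ N → partialSum a N ≤ b) → ∀ ε → 0# < ε →
    ∃ λ N → ∀ M → partialSum (λ k → a (N ℕ.+ k)) M ≤ ε
  small-tail a b 0≤a ≤b ε 0<ε = result
    where
    supremum : ∃ (IsSupremum λ y → ∃ λ N → y ≈ partialSum a N)
    supremum = complete _ (0# , 0 , refl) (b , λ { y (N , eq) → ≤-trans (≤-reflexive eq) (≤b N) })

    s : ℝ
    s = proj₁ supremum

    result : ∃ λ N → ∀ M → partialSum (λ k → a (N ℕ.+ k)) M ≤ ε
    result with em {∃ λ N → s ≤ partialSum a N + ε}
    ... | yes (N , s≤) = N , λ M → lin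
        (≤-trans (≤-resp (partialSum-+ a N M) refl (proj₁ (proj₂ supremum) _ (N ℕ.+ M , refl))) s≤)
        (solve 3 (λ A S e → S :+ (A :+ e) := e :+ (A :+ S)) refl (partialSum a N) (partialSum (λ k → a (N ℕ.+ k)) M) ε)
    ... | no ¬∃ = ⊥-elim (<⇒≱ 0<ε
        (lin (proj₂ (proj₂ supremum) (s + - ε) λ { y (N , eq) → ≤-trans (≤-reflexive eq)
               (lin (≰⇒≥ (λ le → ¬∃ (N , le))) (solve 3 (λ A s e → A :+ s := (s :+ :- e) :+ (A :+ e)) refl (partialSum a N) s ε)) })
          (solve 2 (λ s e → e :+ (s :+ :- e) := :0 :+ s) refl s ε)))

  condensed : ℕ → (ℕ → ℝ) → ℕ → ℝ
  condensed d ψ t = ℕ⇒ℝ ((2 ℕ.^ t) ℕ.^ suc d) * ψ (2 ℕ.^ suc t)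

  -- There are `2 ^ t` indices `k` with `2 ^ t < k ≤ 2 ^ (t + 1)`. On them the power is bounded
  -- below at the left end and `ψ` at the right end, which explains the two different exponents in
  -- `condensed`.
  condensation : ∀ d ψ → (∀ j k → 1 ℕ.≤ j → j ℕ.≤ k → ψ k ≤ ψ j) → (∀ k → 1 ℕ.≤ k → 0# ≤ ψ k) → ∀ M →
    partialSum (condensed d ψ) M ≤ partialSum (λ k → ℕ⇒ℝ (suc k) ^ d * ψ (suc k)) (2 ℕ.^ M)
  condensation d ψ mono 0≤ψ zero = 0≤x+y (*-nonNeg (^-nonNeg d (0≤ℕ⇒ℝ 1)) (0≤ψ 1 (s≤s z≤n))) ≤-refl
  condensation d ψ mono 0≤ψ (suc M) = ≤-resp
    (sym (partialSum-suc (condensed d ψ) M))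
    (sym (trans (reflexive (≡.cong (partialSum f) (≡.cong (N ℕ.+_) (ℕₚ.+-identityʳ N)))) (partialSum-+ f N N)))
    (+-mono-≤ (condensation d ψ mono 0≤ψ M) block)
    where
    N = 2 ℕ.^ M
    f : ℕ → ℝ
    f k = ℕ⇒ℝ (suc k) ^ d * ψ (suc k)

    c : ℝ
    c = ℕ⇒ℝ N ^ d * ψ (2 ℕ.^ suc M)

    ^-mono : ∀ {x y} k → 0# ≤ x → x ≤ y → x ^ k ≤ y ^ k
    ^-mono zero    0≤x x≤y = ≤-refl
    ^-mono (suc k) 0≤x x≤y = *-mono-≤ (≤-trans 0≤x x≤y) (^-nonNeg k 0≤x) x≤y (^-mono k 0≤x x≤y)

    term : ∀ k → k ℕ.< N → c ≤ f (N ℕ.+ k)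
    term k k<N = *-mono-≤ (^-nonNeg d (0≤ℕ⇒ℝ (suc (N ℕ.+ k)))) (0≤ψ _ (ℕₚ.m^n>0 2 (suc M)))
      (^-mono d (0≤ℕ⇒ℝ N) (ℕ⇒ℝ-mono (ℕₚ.m≤n⇒m≤1+n (ℕₚ.m≤m+n N k))))
      (mono (suc (N ℕ.+ k)) (2 ℕ.^ suc M) (s≤s z≤n)
        (≡.subst (suc (N ℕ.+ k) ℕ.≤_) (≡.cong (N ℕ.+_) (≡.sym (ℕₚ.+-identityʳ N))) (ℕₚ.+-monoʳ-< N k<N)))

    block : condensed d ψ M ≤ partialSum (λ k → f (N ℕ.+ k)) N
    block = ≤-trans (≤-reflexive (trans
        (trans (*-congʳ (trans (ℕ⇒ℝ-* N (N ℕ.^ d)) (*-congˡ (ℕ⇒ℝ-^ N d)))) (*-assoc _ _ _))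
        (sym (partialSum-const c N))))
      (partialSum-mono N term)

  scale-down : ∀ K ε → 0# ≤ K → 0# < ε → ∃ λ δ → 0# < δ ∧ K * δ ≤ ε
  scale-down K ε 0≤K 0<ε =
    -- Divide by `1 + K` rather than by `K`, which may be 0.
    let (y , 0≤y , eq) = positive-inverse {1# + K} (<-≤-trans 0<1 (x≤x+y 0≤K))
        0<y = ≰⇒> λ y≤0 → 1≰0 (≤-trans (≤-reflexive (trans (sym eq) (*-congˡ (≤-antisym y≤0 0≤y)))) (≤-reflexive (zeroʳ _)))
    in y * ε , *-pos 0<y 0<ε ,
       ≤-trans (lin (*-nonNeg 0≤y (proj₁ 0<ε))
                 (solve 3 (λ K y e → K :* (y :* e) :+ y :* e := ((:1 :+ K) :* y) :* e :+ :0) refl K y ε))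
               (≤-reflexive (trans (*-congʳ eq) (*-identityˡ ε)))

  -- Borel-Cantelli

  totalVolume-nonNeg : ∀ {d} (L : List (Box d)) → 0# ≤ totalVolume L
  totalVolume-nonNeg []      = ≤-refl
  totalVolume-nonNeg (B ∷ L) = 0≤x+y (volume-nonNeg B) (totalVolume-nonNeg L)

  Covers : ∀ {d} → List (Box d) → Pred (Vector ℝ d) 0ℓ
  Covers L x = Any (λ B → Box._∋_ B x) L

  TailCover : ∀ {d} → (ℕ → Pred (Vector ℝ d) 0ℓ) → ℝ → Set
  TailCover {d} E ε = ∃ λ t₀ → ∃ λ (L : ℕ → List (Box d)) →
    (∀ t x → E (t₀ ℕ.+ t) x → Covers (L t) x) ∧ (∀ M → partialSum (totalVolume ∘ L) M ≤ ε)

  TailNull : ∀ {d} → (ℕ → Pred (Vector ℝ d) 0ℓ) → Set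
  TailNull E = ∀ ε → 0# < ε → TailCover E ε

  tail-null : ∀ {d} (E : ℕ → Pred (Vector ℝ d) 0ℓ) (a : ℕ → ℝ) b K → 0# ≤ K →
    (∀ t → 0# ≤ a t) → (∀ N → partialSum a N ≤ b) →
    (∀ t → K * a t ≤ 1# → Cover (E t) (K * a t)) → TailNull E
  tail-null {d} E a b K 0≤K 0≤a ≤b cov ε 0<ε =
    t₀ , (λ t → proj₁ (cover t)) , (λ t → proj₁ (proj₂ (cover t))) ,
    λ M → ≤-trans (partialSum-mono M (λ t _ → proj₂ (proj₂ (cover t))))
      (≤-trans (≤-reflexive (partialSum-scale K (λ t → a (t₀ ℕ.+ t)) M))
        (≤-trans (*-monoʳ-≤ K 0≤K (proj₂ tail-small M)) (proj₁ Kδ≤)))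
    where
    -- The bound by 1 is for the smallness hypothesis of `cov`: each term past `t₀` is at most a
    -- partial sum of the tail, hence at most `δ`.
    threshold : ∃ λ δ → 0# < δ ∧ (K * δ ≤ ε ∧ K * δ ≤ 1#)
    threshold with ≤-total ε 1#
    ... | inj₁ ε≤1 = let (δ , 0<δ , le) = scale-down K ε 0≤K 0<ε in δ , 0<δ , le , ≤-trans le ε≤1
    ... | inj₂ 1≤ε = let (δ , 0<δ , le) = scale-down K 1# 0≤K 0<1 in δ , 0<δ , ≤-trans le 1≤ε , le

    δ = proj₁ threshold
    Kδ≤ = proj₂ (proj₂ threshold)

    tail-small : ∃ λ N → ∀ M → partialSum (λ k → a (N ℕ.+ k)) M ≤ δ
    tail-small = small-tail a b 0≤a ≤b δ (proj₁ (proj₂ threshold))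

    t₀ = proj₁ tail-small

    cover : ∀ t → Cover (E (t₀ ℕ.+ t)) (K * a (t₀ ℕ.+ t))
    cover t = cov (t₀ ℕ.+ t) (≤-trans
      (*-monoʳ-≤ K 0≤K (≤-trans (term≤partialSum {λ k → a (t₀ ℕ.+ k)} t (λ k → 0≤a (t₀ ℕ.+ k))) (proj₂ tail-small (suc t))))
      (proj₂ Kδ≤))

  -- The upper limit of the sets `E t`.
  FrequentlyIn : ∀ {d} → (ℕ → Pred (Vector ℝ d) 0ℓ) → Pred (Vector ℝ d) 0ℓ
  FrequentlyIn E x = ∀ t₀ → ∃ λ t → t₀ ℕ.≤ t ∧ E t x

  geometric : ∀ ε → 0# < ε → ∃ λ (η : ℕ → ℝ) → (∀ k → 0# < η k) ∧ (∀ N → partialSum η N ≤ ε)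
  geometric ε 0<ε = η , η-pos ε 0<ε , λ N → ≤-trans (x≤x+y (proj₁ (rest-pos N ε 0<ε))) (≤-reflexive (telescope N ε))
    where
    half = proj₁ (positive-inverse {2#} (0<ℕ⇒ℝ 2))
    2*half = proj₂ (proj₂ (positive-inverse {2#} (0<ℕ⇒ℝ 2)))

    0<half : 0# < half
    0<half = ≰⇒> λ h≤0 → 1≰0 (≤-trans (≤-reflexive (sym 2*half))
      (≤-resp refl (zeroʳ 2#) (*-monoʳ-≤ 2# (0≤ℕ⇒ℝ 2) h≤0)))

    -- `rest k x` is `x / 2 ^ k`, so the weights are `ε / 2 ^ (k + 1)`.
    rest : ℕ → ℝ → ℝ
    rest zero    x = x
    rest (suc k) x = rest k (half * x)

    rest-pos : ∀ k x → 0# < x → 0# < rest k x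
    rest-pos zero    x 0<x = 0<x
    rest-pos (suc k) x 0<x = rest-pos k (half * x) (*-pos 0<half 0<x)

    η : ℕ → ℝ
    η k = rest k (half * ε)

    η-pos : ∀ x → 0# < x → ∀ k → 0# < rest k (half * x)
    η-pos x 0<x k = rest-pos k (half * x) (*-pos 0<half 0<x)

    telescope : ∀ N x → partialSum (λ k → rest k (half * x)) N + rest N x ≈ x
    telescope zero    x = +-identityˡ x
    telescope (suc N) x = trans (+-assoc _ _ _) (trans (+-congˡ (telescope N (half * x)))
      (trans (solve 2 (λ h x → h :* x :+ h :* x := (:2 :* h) :* x) refl half x)
        (trans (*-congʳ 2*half) (*-identityˡ x))))

  module Stack {d} (L : ℕ → ℕ → List (Box d)) where

    stack : ℕ → ℕ → List (Box d)
    stack zero    s = []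
    stack (suc k) s = stack k s ++ L k s

    stack-volume : ∀ k s → totalVolume (stack k s) ≈ partialSum (λ T → totalVolume (L T s)) k
    stack-volume zero    s = refl
    stack-volume (suc k) s = trans (totalVolume-++ (stack k s) (L k s))
      (trans (+-congʳ (stack-volume k s)) (sym (partialSum-suc (λ T → totalVolume (L T s)) k)))

    in-stack : ∀ {T k} s x → T ℕ.< k → Covers (L T s) x → Covers (stack k s) x
    in-stack {T} {suc k} s x (s≤s T≤k) c with ℕₚ.m≤n⇒m<n∨m≡n T≤k
    ... | inj₁ T<k    = Anyₚ.++⁺ˡ (in-stack s x T<k c)
    ... | inj₂ ≡.refl = Anyₚ.++⁺ʳ (stack k s) c

  module _ {d} (F : ℕ → ℕ → Pred (Vector ℝ d) 0ℓ) (null : ∀ T → TailNull (F T)) where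

    -- Merges the coverings for all `T` into one sequence of finite lists by a triangular
    -- arrangement: position `s` holds the lists `L T s` with `T ≤ s`. For each `T` finitely many
    -- lists are dropped, which a point of the upper limit does not notice.
    frequent-cover : ∀ ε → 0# < ε → ∃ λ (L : ℕ → List (Box d)) →
      (∀ T x → FrequentlyIn (F T) x → ∃ λ s → Covers (L s) x) ∧
      (∀ M → partialSum (totalVolume ∘ L) M ≤ ε)
    frequent-cover ε 0<ε = (λ s → stack (suc s) s) , covered , volume≤
      where
      weights : ∃ λ (η : ℕ → ℝ) → (∀ k → 0# < η k) ∧ (∀ N → partialSum η N ≤ ε)
      weights = geometric ε 0<ε

      η : ℕ → ℝ
      η = proj₁ weights

      cover : ∀ T → TailCover (F T) (η T)
      cover T = null T (η T) (proj₁ (proj₂ weights) T)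

      t₀ : ℕ → ℕ
      t₀ T = proj₁ (cover T)

      L : ℕ → ℕ → List (Box d)
      L T = proj₁ (proj₂ (cover T))

      open Stack L

      covered : ∀ T x → FrequentlyIn (F T) x → ∃ λ s → Covers (stack (suc s) s) x
      covered T x freq =
        -- Asking for `t` beyond `t₀ T + T` puts `s` at `T` or later, where the lists of `T` are
        -- present.
        let (t , t₀+T≤t , x∈) = freq (t₀ T ℕ.+ T)
            s = t ℕ.∸ t₀ T
            t≡ = ℕₚ.m+[n∸m]≡n (ℕₚ.≤-trans (ℕₚ.m≤m+n (t₀ T) T) t₀+T≤t)
            T≤s = ℕₚ.+-cancelˡ-≤ (t₀ T) T s (≡.subst (t₀ T ℕ.+ T ℕ.≤_) (≡.sym t≡) t₀+T≤t)
        in s , in-stack s x (s≤s T≤s)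
             (proj₁ (proj₂ (proj₂ (cover T))) s x (≡.subst (λ r → F T r x) (≡.sym t≡) x∈))

      volume≤ : ∀ M → partialSum (λ s → totalVolume (stack (suc s) s)) M ≤ ε
      -- Enlarge the triangle `T ≤ s` to a square and exchange the two sums.
      volume≤ M = ≤-trans
        (partialSum-mono M λ s s<M → ≤-trans (≤-reflexive (stack-volume (suc s) s))
          (partialSum-monoˡ {λ T → totalVolume (L T s)} (λ T → totalVolume-nonNeg (L T s)) s<M))
        (≤-trans (≤-reflexive (∑-comm {M} {M} (λ s T → totalVolume (L (toℕ T) (toℕ s)))))
          (≤-trans (partialSum-mono M (λ T _ → proj₂ (proj₂ (proj₂ (cover T))) M))
            (proj₂ (proj₂ weights) M)))

  -- Volume zero

  module _ {A : Set} where

    -- Every exhausted list spends one index on `nothing`, so the recursion on the index is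
    -- structural even if all lists are empty.
    concatenate : List A → (ℕ → List A) → ℕ → Maybe A
    concatenate []       L zero    = nothing
    concatenate []       L (suc k) = concatenate (L 0) (L ∘ suc) k
    concatenate (x ∷ xs) L zero    = just x
    concatenate (x ∷ xs) L (suc k) = concatenate xs L k

    Hits : (A → Set) → (ℕ → Maybe A) → Set
    Hits Q f = ∃ λ k → ∃ λ x → f k ≡ just x ∧ Q x

    hits-head : ∀ {Q xs L} → Any Q xs → Hits Q (concatenate xs L)
    hits-head (here q)  = 0 , _ , ≡.refl , q
    hits-head (there a) = let (k , hit) = hits-head a in suc k , hit

    hits-tail : ∀ {Q} xs {L} → Hits Q (concatenate (L 0) (L ∘ suc)) → Hits Q (concatenate xs L)
    hits-tail []       (k , hit) = suc k , hit
    hits-tail (x ∷ xs) h         = let (k , hit) = hits-tail xs h in suc k , hit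

    hits : ∀ {Q} s xs L → Any Q (L s) → Hits Q (concatenate xs L)
    hits zero    xs L a = hits-tail xs {L} (hits-head a)
    hits (suc s) xs L a = hits-tail xs {L} (hits s (L 0) (L ∘ suc) a)

  chartFactor : ∀ {d} → Vector ℝ (suc d) → ℝ
  chartFactor α = sqrt (1# + tail α · tail α) (0≤1+x·x (tail α))

  chartFactor-nonNeg : ∀ {d} (α : Vector ℝ (suc d)) → 0# ≤ chartFactor α
  chartFactor-nonNeg α = proj₁ (sqrt-isSupremum _ (0≤1+x·x (tail α))) 0#
    (≤-trans (≤-reflexive (zeroˡ 0#)) (0≤1+x·x (tail α)))

  -- Passing to the next list uses up an index, so `N` indices reach at most `N` lists beyond `xs`.
  patchVolume-concatenate : ∀ {d} (α : Vector ℝ (suc d)) N xs (L : ℕ → List (Box d)) →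
    partialSum (λ k → patchVolume α (concatenate xs L k)) N
      ≤ chartFactor α * (totalVolume xs + partialSum (totalVolume ∘ L) N)
  patchVolume-concatenate α zero xs L =
    *-nonNeg (chartFactor-nonNeg α) (0≤x+y (totalVolume-nonNeg xs) ≤-refl)
  patchVolume-concatenate α (suc N) [] L = ≤-resp (sym (+-identityˡ _)) (*-congˡ (sym (+-identityˡ _)))
    (patchVolume-concatenate α N (L 0) (L ∘ suc))
  patchVolume-concatenate α (suc N) (B ∷ xs) L = ≤-trans
    (+-monoʳ-≤ _ (≤-trans (patchVolume-concatenate α N xs L)
      (*-monoʳ-≤ _ (chartFactor-nonNeg α)
        (+-monoʳ-≤ _ (partialSum-monoˡ {totalVolume ∘ L} (totalVolume-nonNeg ∘ L) (ℕₚ.n≤1+n N))))))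
    (≤-reflexive (solve 4 (λ J b x p → J :* b :+ J :* (x :+ p) := J :* ((b :+ x) :+ p)) refl
      (chartFactor α) (Box.volume B) (totalVolume xs) (partialSum (totalVolume ∘ L) (suc N))))

  volumeZero-frequent : ∀ {d} (α : Vector ℝ (suc d)) (S : Pred (Vector ℝ (suc d)) 0ℓ)
    (F : ℕ → ℕ → Pred (Vector ℝ d) 0ℓ) → (∀ T → TailNull (F T)) →
    (∀ y → S y → ∃ λ x → y ≋ graph α x ∧ ∃ λ T → FrequentlyIn (F T) x) →
    VolumeZero α S
  volumeZero-frequent α S F null S⊆ ε 0<ε =
    concatenate [] L , covered , λ N → ≤-trans (patchVolume-concatenate α N [] L)
      (≤-trans (*-monoʳ-≤ _ (chartFactor-nonNeg α) (≤-trans (≤-reflexive (+-identityˡ _)) (proj₂ (proj₂ cover) N)))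
        (proj₂ (proj₂ δ)))
    where
    δ = scale-down (chartFactor α) ε (chartFactor-nonNeg α) 0<ε
    cover = frequent-cover F null (proj₁ δ) (proj₁ (proj₂ δ))
    L = proj₁ cover

    covered : ∀ y → S y → ∃ λ k → Patch α (concatenate [] L k) y
    covered y y∈ =
      let (x , y≋ , T , freq) = S⊆ y y∈
          (s , x∈) = proj₁ (proj₂ cover) T x freq
          (k , B , eq , B∋x) = hits s [] L x∈
      in k , ≡.subst (λ m → Patch α m y) (≡.sym eq) (x , B∋x , y≋)

  volumeZero-∅ : ∀ {d} (α : Vector ℝ (suc d)) (S : Pred (Vector ℝ (suc d)) 0ℓ) → (∀ y → ¬ S y) → VolumeZero α S
  volumeZero-∅ α S empty ε 0<ε = (λ _ → nothing) , (λ y y∈ → ⊥-elim (empty y y∈)) ,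
    λ N → ≤-trans (≤-reflexive (trans (partialSum-const 0# N) (zeroʳ _))) (proj₁ 0<ε)

  -- Integer vectors of large norm

  integers : ℕ → List ℤ
  integers B = List.map +_ (List.upTo (suc B)) ++ List.map -[1+_] (List.upTo B)

  ∈-integers : ∀ {B} i → ℤ.∣ i ∣ ℕ.≤ B → i ∈ integers B
  ∈-integers (+ k)        k≤B = ∈-++⁺ˡ (∈-map⁺ +_ (∈-upTo⁺ (s≤s k≤B)))
  ∈-integers {B} -[1+ k ] k<B = ∈-++⁺ʳ (List.map +_ (List.upTo (suc B))) (∈-map⁺ -[1+_] (∈-upTo⁺ k<B))

  integerVectors : ∀ n → ℕ → List (Vec ℤ n)
  integerVectors zero    B = Vec.[] ∷ []
  integerVectors (suc n) B = List.cartesianProductWith Vec._∷_ (integers B) (integerVectors n B)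

  ∈-integerVectors : ∀ {n B} (q : Vec ℤ n) → ‖ q ‖ ℕ.≤ B → q ∈ integerVectors n B
  ∈-integerVectors Vec.[] _ = here ≡.refl
  ∈-integerVectors {B = B} (i Vec.∷ q) le = ∈-cartesianProductWith⁺ Vec._∷_
    (∈-integers i (ℕₚ.≤-trans (ℕₚ.m≤m⊔n ℤ.∣ i ∣ ‖ q ‖) le))
    (∈-integerVectors q (ℕₚ.≤-trans (ℕₚ.m≤n⊔m ℤ.∣ i ∣ ‖ q ‖) le))

  -- Otherwise all solutions would lie in a ball of the maximum norm, whose integer points form a
  -- finite list.
  infinitelyMany⇒unbounded : ∀ {n} {P : Pred (Vec ℤ n) 0ℓ} → InfinitelyMany P → ∀ B → ∃ λ q → B ℕ.≤ ‖ q ‖ ∧ P q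
  infinitelyMany⇒unbounded {n} {P} inf B with em {∃ λ q → B ℕ.≤ ‖ q ‖ ∧ P q}
  ... | yes found = found
  ... | no ¬found = ⊥-elim (inf (integerVectors n B , λ q Pq → ∈-integerVectors q
          (ℕₚ.<⇒≤ (ℕₚ.≰⇒> λ B≤ → ¬found (q , B≤ , Pq)))))

  ∣lookup∣≤‖‖ : ∀ {n} (q : Vec ℤ n) i → ℤ.∣ lookup q i ∣ ℕ.≤ ‖ q ‖
  ∣lookup∣≤‖‖ (z Vec.∷ q) zero    = ℕₚ.m≤m⊔n ℤ.∣ z ∣ ‖ q ‖
  ∣lookup∣≤‖‖ (z Vec.∷ q) (suc i) = ℕₚ.≤-trans (∣lookup∣≤‖‖ q i) (ℕₚ.m≤n⊔m ℤ.∣ z ∣ ‖ q ‖)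

  zero⇒‖‖≡0 : ∀ {n} (q : Vec ℤ n) → (∀ i → lookup q i ≡ ℤ.0ℤ) → ‖ q ‖ ≡ 0
  zero⇒‖‖≡0 Vec.[]        zeros = ≡.refl
  zero⇒‖‖≡0 (z Vec.∷ q) zeros rewrite zeros zero = zero⇒‖‖≡0 q (zeros ∘ suc)

  n<2^n : ∀ n → n ℕ.< 2 ℕ.^ n
  n<2^n zero    = s≤s z≤n
  n<2^n (suc n) = ℕₚ.≤-trans (s≤s (n<2^n n)) (ℕₚ.≤-trans
    (ℕₚ.+-monoˡ-≤ (2 ℕ.^ n) (ℕₚ.m^n>0 2 n)) (ℕₚ.≤-reflexive (≡.cong (2 ℕ.^ n ℕ.+_) (≡.sym (ℕₚ.+-identityʳ _)))))

  dyadic-scale : ∀ t₀ k → 2 ℕ.^ t₀ ℕ.≤ k → ∃ λ t → t₀ ℕ.≤ t ∧ 2 ℕ.^ t ℕ.≤ k ∧ k ℕ.< 2 ℕ.^ suc t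
  -- The search runs upward from `t₀` with `k` as fuel, which suffices because `k < 2 ^ k`.
  dyadic-scale t₀ k = go k t₀ (ℕₚ.<-≤-trans (n<2^n k) (ℕₚ.^-monoʳ-≤ 2 (ℕₚ.m≤n+m k t₀)))
    where
    go : ∀ m t → k ℕ.< 2 ℕ.^ (t ℕ.+ m) → 2 ℕ.^ t ℕ.≤ k → ∃ λ t′ → t ℕ.≤ t′ ∧ 2 ℕ.^ t′ ℕ.≤ k ∧ k ℕ.< 2 ℕ.^ suc t′
    go zero    t k< ≤k = ⊥-elim (ℕₚ.<⇒≱ k< (≡.subst (λ s → 2 ℕ.^ s ℕ.≤ k) (≡.sym (ℕₚ.+-identityʳ t)) ≤k))
    go (suc m) t k< ≤k with k ℕₚ.<? 2 ℕ.^ suc t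
    ... | yes k<2^ = t , ℕₚ.≤-refl , ≤k , k<2^
    ... | no  k≮2^ =
      let (t′ , t<t′ , bounds) = go m (suc t) (≡.subst (λ s → k ℕ.< 2 ℕ.^ s) (ℕₚ.+-suc t m) k<) (ℕₚ.≮⇒≥ k≮2^)
      in t′ , ℕₚ.<⇒≤ t<t′ , bounds

  -- From the hyperplane to its chart

  dot-affine : ∀ {d} (x a b : Vector ℝ d) c → x · (λ j → a j + b j * c) ≈ x · a + (x · b) * c
  dot-affine {zero}  x a b c = sym (trans (+-identityˡ _) (zeroˡ c))
  dot-affine {suc d} x a b c = trans (+-congˡ (dot-affine (tail x) (tail a) (tail b) (c)))
    (solve 6 (λ x a b c p q → x :* (a :+ b :* c) :+ (p :+ q :* c) := (x :* a :+ p) :+ (x :* b :+ q) :* c) refl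
      (x zero) (a zero) (b zero) c (tail x · tail a) (tail x · tail b))

  module _ {d} (α : Vector ℝ (suc d)) (q : Vec ℤ (suc d)) where

    last : Fin (suc d)
    last = fromℕ d

    coordinates : ℤ → Vector ℤ (suc d)
    coordinates p = p ◂ (λ j → lookup q (punchIn last j))

    linear-form : ∀ p (x : Vector ℝ d) y → y ≋ graph α x →
      ℤ⇒ℝ p + y · (λ i → ℤ⇒ℝ (lookup q i)) ≈ (1# ◂ x) · point α (lookup q last) (coordinates p)
    linear-form p x y y≋ = begin
      ℤ⇒ℝ p + y · q′                                      ≈⟨ +-congˡ (dot-cong {v = q′} y≋ (λ _ → refl)) ⟩
      ℤ⇒ℝ p + graph α x · q′                              ≈⟨ +-congˡ (sum-remove {i = last} (Vector.zipWith _*_ (graph α x) q′)) ⟩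
      ℤ⇒ℝ p + (graph α x last * c + (λ j → graph α x (punchIn last j)) · r)
        ≈⟨ +-congˡ (+-cong (*-congʳ (reflexive (Vectorₚ.insertAt-lookup x last _)))
             (dot-cong {v = r} (λ j → reflexive (Vectorₚ.insertAt-punchIn x last _ j)) (λ _ → refl))) ⟩
      ℤ⇒ℝ p + ((1# * α zero + x · tail α) * c + x · r)
        ≈⟨ solve 5 (λ p a y c z → p :+ ((:1 :* a :+ y) :* c :+ z) := :1 :* (p :+ a :* c) :+ (z :+ y :* c)) refl
             (ℤ⇒ℝ p) (α zero) (x · tail α) c (x · r) ⟩
      1# * (ℤ⇒ℝ p + α zero * c) + (x · r + (x · tail α) * c)
        ≈⟨ +-congˡ (sym (dot-affine x r (tail α) c)) ⟩
      (1# ◂ x) · point α (lookup q last) (coordinates p)  ∎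
      where
      open SetoidReasoning setoid
      q′ : Vector ℝ (suc d)
      q′ i = ℤ⇒ℝ (lookup q i)
      r : Vector ℝ d
      r j = q′ (punchIn last j)
      c = q′ last

    nontrivial : ∀ p → 1 ℕ.≤ ‖ q ‖ → Nontrivial (lookup q last) (coordinates p)
    nontrivial p 1≤‖q‖ with em {Nontrivial (lookup q last) (coordinates p)}
    ... | yes found = found
    ... | no trivial = ⊥-elim (ℕₚ.<⇒≢ 1≤‖q‖ (≡.sym (zero⇒‖‖≡0 q zeros)))
      where
      zeros : ∀ i → lookup q i ≡ ℤ.0ℤ
      zeros i with lookup q i ℤₚ.≟ ℤ.0ℤ
      ... | yes eq = eq
      ... | no neq with last Finₚ.≟ i
      ...   | yes ≡.refl = ⊥-elim (trivial (inj₁ neq))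
      ...   | no last≢i = ⊥-elim (trivial (inj₂ (Fin.punchOut last≢i ,
                λ eq → neq (≡.trans (≡.cong (lookup q) (≡.sym (Finₚ.punchIn-punchOut last≢i))) eq))))

  -- The levels of ψ and the conclusion

  module _ {d} (α : Vector ℝ (suc d)) (ψ : ℕ → ℝ) (antitone : ∀ j k → 1 ℕ.≤ j → j ℕ.≤ k → ψ k ≤ ψ j) where

    -- Meant for integer vectors with `2 ^ (t + 1) ≤ ‖ q ‖ < 2 ^ (t + 2)`: the upper end bounds the
    -- entries, and the lower end bounds `ψ ‖ q ‖` by monotonicity.
    ψ-Level : ℕ → ℕ → Pred (Vector ℝ d) 0ℓ
    ψ-Level T t = Level α T (2 ℕ.^ (2 ℕ.+ t)) (ψ (2 ℕ.^ suc t))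

    ℒ⊆frequent : ∀ y → ℒ (Hyperplane α) ψ y → ∃ λ x → y ≋ graph α x ∧ ∃ λ T → FrequentlyIn (ψ-Level T) x
    ℒ⊆frequent y ((x , y≋) , inf) = x , y≋ , T , frequent
      where
      T = proj₁ (archimedean (maxNorm x))

      x∈ : InCube (suc T) x
      x∈ j = ≤-trans (∣x∣≤maxNorm x j) (≤-trans (proj₂ (archimedean (maxNorm x))) (ℕ⇒ℝ-mono (ℕₚ.n≤1+n T)))

      frequent : FrequentlyIn (ψ-Level T) x
      frequent t₀ with infinitelyMany⇒unbounded inf (2 ℕ.^ suc t₀)
      -- Starting at `suc t₀` makes the exponent found a successor, whose predecessor is the index
      -- of the level.
      ... | q , 2^≤ , p , lt with dyadic-scale (suc t₀) ‖ q ‖ 2^≤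
      ...   | suc t , s≤s t₀≤t , 2^t≤ , <2^ =
        t , t₀≤t , lookup q (last α q) , coordinates α q p ,
        nontrivial α q p (ℕₚ.≤-trans (ℕₚ.m^n>0 2 (suc t)) 2^t≤) ,
        entry≤ (last α q) , (λ j → entry≤ (punchIn (last α q) j)) , x∈ ,
        ≤-resp (∣∣-cong (linear-form α q p x y y≋)) refl
          (≤-trans (proj₁ lt) (antitone (2 ℕ.^ suc t) ‖ q ‖ (ℕₚ.m^n>0 2 (suc t)) 2^t≤))
        where
        entry≤ : ∀ i → ℤ.∣ lookup q i ∣ ℕ.≤ 2 ℕ.^ (2 ℕ.+ t)
        entry≤ i = ℕₚ.≤-trans (∣lookup∣≤‖‖ q i) (ℕₚ.<⇒≤ <2^)

    -- An absolute value is never below a nonpositive `ψ ‖ q ‖`, so solutions could only have norm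
    -- below `K`. With this case removed, all slabs have positive width.
    ℒ-empty : ∀ K → 1 ℕ.≤ K → ψ K ≤ 0# → ∀ y → ¬ ℒ (Hyperplane α) ψ y
    ℒ-empty K 1≤K ψK≤0 y (_ , inf) =
      let (q , K≤ , p , lt) = infinitelyMany⇒unbounded inf K
      in <⇒≱ lt (≤-trans (antitone K ‖ q ‖ 1≤K K≤) (≤-trans ψK≤0 (0≤∣x∣ _)))

    ψ-Level-null : (∀ k → 1 ℕ.≤ k → 0# < ψ k) → ¬ 𝒲⁻ (suc d) (ℕ⇒ℝ (suc d)) α →
      SeriesFinite (λ k → ℕ⇒ℝ k ^ d * ψ k) → ∀ T → TailNull (ψ-Level T)
    ψ-Level-null 0<ψ ¬𝒲⁻α (b , ≤b) T = tail-null (ψ-Level T) (condensed d ψ) b K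
      (0≤ℕ⇒ℝ (Φ ℕ.* 4 ℕ.^ suc d))
      (λ t → *-nonNeg (0≤ℕ⇒ℝ ((2 ℕ.^ t) ℕ.^ suc d)) (0≤ψ (2 ℕ.^ suc t) (ℕₚ.m^n>0 2 (suc t))))
      (λ N → ≤-trans (condensation d ψ antitone 0≤ψ N) (≤b (2 ℕ.^ N)))
      (λ t small → cover-mono (λ _ x∈ → x∈) (≤-reflexive (cost t))
        (proj₂ Φ-cover (2 ℕ.+ t) (ψ (2 ℕ.^ suc t)) (0<ψ (2 ℕ.^ suc t) (ℕₚ.m^n>0 2 (suc t)))
          (≤-trans (≤-reflexive (cost t)) small)))
      where
      0≤ψ : ∀ k → 1 ℕ.≤ k → 0# ≤ ψ k
      0≤ψ k 1≤k = proj₁ (0<ψ k 1≤k)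

      C-bad = ¬𝒲⁻⇒BadlyApproximable α ¬𝒲⁻α

      Φ-cover : ∃ (LevelCost α T)
      Φ-cover = level-cover α (proj₁ C-bad) (proj₁ (proj₂ C-bad)) (proj₂ (proj₂ C-bad)) T

      Φ : ℕ
      Φ = proj₁ Φ-cover

      -- The entries at level `t` go up to `4 * 2 ^ t`, whereas `condensed` is weighted by a power
      -- of `2 ^ t`; the ratio accounts for `4 ^ suc d`.
      K : ℝ
      K = ℕ⇒ℝ (Φ ℕ.* 4 ℕ.^ suc d)

      cost : ∀ t → ℕ⇒ℝ (Φ ℕ.* (2 ℕ.^ (2 ℕ.+ t)) ℕ.^ suc d) * ψ (2 ℕ.^ suc t) ≈ K * condensed d ψ t
      cost t = trans (*-congʳ (trans (ℕ⇒ℝ-cong eq) (ℕ⇒ℝ-* (Φ ℕ.* 4 ℕ.^ suc d) ((2 ℕ.^ t) ℕ.^ suc d)))) (*-assoc _ _ _)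
        where
        eq : Φ ℕ.* (2 ℕ.^ (2 ℕ.+ t)) ℕ.^ suc d ≡ Φ ℕ.* 4 ℕ.^ suc d ℕ.* (2 ℕ.^ t) ℕ.^ suc d
        eq = ≡.trans (≡.cong (λ m → Φ ℕ.* m ℕ.^ suc d) (≡.sym (ℕₚ.*-assoc 2 2 (2 ℕ.^ t))))
          (≡.trans (≡.cong (Φ ℕ.*_) (^-distribʳ-* (suc d) 4 (2 ℕ.^ t))) (≡.sym (ℕₚ.*-assoc Φ _ _)))

  khintchine : ∀ d ψ → (∀ j k → 1 ℕ.≤ j → j ℕ.≤ k → ψ k ≤ ψ j) → (α : Vector ℝ (suc d)) →
    ¬ 𝒲⁻ (suc d) (ℕ⇒ℝ (suc d)) α → SeriesFinite (λ k → ℕ⇒ℝ k ^ d * ψ k) →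
    VolumeZero α (ℒ (Hyperplane α) ψ)
  khintchine d ψ antitone α ¬𝒲⁻α finite with em {∃ λ K → 1 ℕ.≤ K ∧ ψ K ≤ 0#}
  ... | yes (K , 1≤K , ψK≤0) = volumeZero-∅ α _ (ℒ-empty α ψ antitone K 1≤K ψK≤0)
  ... | no ¬∃ = volumeZero-frequent α _ (ψ-Level α ψ antitone)
    (ψ-Level-null α ψ antitone (λ k 1≤k → ≰⇒> λ ψk≤0 → ¬∃ (k , 1≤k , ψk≤0)) ¬𝒲⁻α finite)
    (ℒ⊆frequent α ψ antitone)

theorem1p6 : (em : ExcludedMiddle 0ℓ) (R : RealField) →
  let open RealAnalysis em R in
  (d : ℕ) →
  let n = suc d in
  (ψ : ℕ → ℝ) →
  (∀ j k → 1 ℕ.≤ j → j ℕ.≤ k → ψ k ≤ ψ j) →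
  (α : Vector ℝ n) →
  ¬ 𝒲⁻ n (ℕ⇒ℝ n) α →
  SeriesFinite (λ k → ℕ⇒ℝ k ^ d * ψ k) →
  VolumeZero α (ℒ (Hyperplane α) ψ)
theorem1p6 em R d ψ antitone α ¬𝒲⁻α finite = Khintchine.khintchine em R d ψ antitone α ¬𝒲⁻α finite
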